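{- For every undirected social network $G(V,E,w)$, the generalized IE strategy $\mathrm{IE}(\vec{q},\vec{p})$ with $K = 6$ pricing classes and assignment probabilities $\vec{q} = (0.183, 0.075, 0.075, 0.175, 0.261, 0.231)$ approximates the maximum revenue of $G$ within a factor of $0.7032$; that is, its expected revenue is at least $0.7032\cdot R_{\max}(G)$.
   Context: An undirected social network $G(V,E,w)$ on a finite set $V$ of $n$ buyers has real weights $w_{ij} = w_{ji} \geq 0$ for distinct $i,j \in V$ (positive exactly on the edges) and a weight $w_{ii} \geq 0$ for each $i \in V$. Marketing strategies (Uniform Additive Model). A marketing strategy $(\vec{\pi},\vec{p})$ consists of a permutation $\vec{\pi}$ of $V$ ($\pi_i$ is the position of buyer $i$) and a vector of pricing probabilities $p_i \in [1/2,1]$, $i\in V$. Its expected revenue is $$R(\vec{\pi},\vec{p}) = \sum_{i\in V} p_i(1-p_i)\Big(w_{ii} + \sum_{j:\pi_j<\pi_i} p_j w_{ji}\Big),$$ and $R_{\max}(G) = \max_{(\vec{\pi},\vec{p})} R(\vec{\pi},\vec{p})$ is the maximum revenue of $G$. Generalized IE strategies. Let $K\ge 2$ be an integer. Class $k\in\{1,\ldots,K\}$ has pricing probability $p_k = 1-\frac{k-1}{2(K-1)}$, and $\vec{q}=(q_1,\ldots,q_K)$ is a probability vector. The generalized IE strategy $\mathrm{IE}(\vec{q},\vec{p})$ assigns each buyer independently to class $k$ with probability $q_k$; a buyer assigned to class $k$ gets pricing probability $p_k$. Buyers in class $k$ are approached before buyers in class $k+1$ for $k=1,\ldots,K-1$,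 and buyers within the same class are approached in uniformly random order. Its expected revenue is the expectation of $R(\cdot,\cdot)$, for the resulting random permutation and pricing probabilities, over the random assignment and the random orders. -}

module Defs where

open import Data.Bool using (if_then_else_)
open import Data.Fin as Fin using (Fin; toℕ)
open import Data.Fin.Permutation using (Permutation′; id; insert; _⟨$⟩ʳ_)
open import Data.Fin.Properties as Fin using (all?)
open import Data.Integer using (+_)
open import Data.List as List using (List; []; _∷_; allFin; concatMap; filter; length; map)
open import Data.Nat as ℕ using (ℕ; zero; suc; NonZero; NonTrivial)
import Data.Nat.Properties as ℕ
open import Data.Product using (_×_; _,_; ∃)
open import Data.Rational as ℚ using (ℚ; 0ℚ; 1ℚ; ½; ∣_∣; _/_)
import Data.Rational.Properties as ℚ
open import Data.Rational.Solver using (module +-*-Solver)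
open import Data.Vec.Functional as Vector using (Vector)
open import Function using (_∘_; _⇔_)
open import Relation.Binary.PropositionalEquality
  using (_≡_; _≢_; refl; sym; trans; cong; subst; module ≡-Reasoning)
open import Relation.Nullary.Decidable using (Dec; does; _→-dec_; toWitness)

-- Real numbers: Cauchy sequences of rationals, with pointwise operations
-- and the usual setoid equality.

IsCauchy : (ℕ → ℚ) → Set
IsCauchy x = ∀ ε → 0ℚ ℚ.< ε → ∃ λ N → ∀ m n → N ℕ.≤ m → N ℕ.≤ n → ∣ x m ℚ.- x n ∣ ℚ.≤ ε

record ℝ : Set where
  no-eta-equality
  constructor mkℝ
  field
    seq    : ℕ → ℚ
    cauchy : IsCauchy seq

open ℝ public

infix 4 _≃_ _≤_ _<_

record _≃_ (x y : ℝ) : Set where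
  constructor mk≃
  field
    un≃ : ∀ ε → 0ℚ ℚ.< ε → ∃ λ N → ∀ n → N ℕ.≤ n → ∣ seq x n ℚ.- seq y n ∣ ℚ.≤ ε

record _≤_ (x y : ℝ) : Set where
  constructor mk≤
  field
    un≤ : ∀ ε → 0ℚ ℚ.< ε → ∃ λ N → ∀ n → N ℕ.≤ n → seq x n ℚ.≤ seq y n ℚ.+ ε

record _<_ (x y : ℝ) : Set where
  constructor mk<
  field
    un< : ∃ λ ε → 0ℚ ℚ.< ε × ∃ λ N → ∀ n → N ℕ.≤ n → seq x n ℚ.+ ε ℚ.≤ seq y n

open _≃_ public
open _≤_ public
open _<_ public

private abstract
  *-pos : ∀ {p q} → 0ℚ ℚ.< p → 0ℚ ℚ.< q → 0ℚ ℚ.< p ℚ.* q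
  *-pos {p} {q} 0<p 0<q =
    ℚ.positive⁻¹ _ {{ℚ.pos*pos⇒pos p {{ℚ.positive 0<p}} q {{ℚ.positive 0<q}}}}

  ½-pos : ∀ {ε} → 0ℚ ℚ.< ε → 0ℚ ℚ.< ½ ℚ.* ε
  ½-pos = *-pos (ℚ.positive⁻¹ ½)

  halves : ∀ ε → ½ ℚ.* ε ℚ.+ ½ ℚ.* ε ≡ ε
  halves ε = trans (sym (ℚ.*-distribʳ-+ ε ½ ½)) (ℚ.*-identityˡ ε)

  *-mono-≤ : ∀ {p p′ q q′} → 0ℚ ℚ.≤ q → 0ℚ ℚ.≤ p′ →
             p ℚ.≤ p′ → q ℚ.≤ q′ → p ℚ.* q ℚ.≤ p′ ℚ.* q′
  *-mono-≤ {p′ = p′} {q = q} 0≤q 0≤p′ p≤p′ q≤q′ = ℚ.≤-trans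
    (ℚ.*-monoʳ-≤-nonNeg q {{ℚ.nonNegative 0≤q}} p≤p′)
    (ℚ.*-monoˡ-≤-nonNeg p′ {{ℚ.nonNegative 0≤p′}} q≤q′)

  ∣*∣≤ : ∀ {p q B C ε} → 0ℚ ℚ.≤ B → B ℚ.* C ≡ ε →
         ∣ p ∣ ℚ.≤ B → ∣ q ∣ ℚ.≤ C → ∣ p ℚ.* q ∣ ℚ.≤ ε
  ∣*∣≤ {p} {q} {B} {C} {ε} 0≤B BC≡ε p≤B q≤C = begin
    ∣ p ℚ.* q ∣      ≡⟨ ℚ.∣p*q∣≡∣p∣*∣q∣ p q ⟩
    ∣ p ∣ ℚ.* ∣ q ∣  ≤⟨ *-mono-≤ (ℚ.0≤∣p∣ q) 0≤B p≤B q≤C ⟩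
    B ℚ.* C          ≡⟨ BC≡ε ⟩
    ε                ∎
    where open ℚ.≤-Reasoning

  ∣0∣≤ : ∀ {p ε} → p ≡ 0ℚ → 0ℚ ℚ.< ε → ∣ p ∣ ℚ.≤ ε
  ∣0∣≤ refl 0<ε = ℚ.<⇒≤ 0<ε

  bounded : ∀ {x} → IsCauchy x →
            ∃ λ B → 0ℚ ℚ.< B × ∃ λ N → ∀ n → N ℕ.≤ n → ∣ x n ∣ ℚ.≤ B
  bounded {x} cx with N , close ← cx 1ℚ (ℚ.positive⁻¹ 1ℚ) =
    1ℚ ℚ.+ ∣ x N ∣ ,
    ℚ.<-≤-trans (ℚ.positive⁻¹ 1ℚ)
      (subst (ℚ._≤ 1ℚ ℚ.+ ∣ x N ∣) (ℚ.+-identityʳ 1ℚ) (ℚ.+-monoʳ-≤ 1ℚ (ℚ.0≤∣p∣ (x N)))) ,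
    N , λ n N≤n →
      subst (λ t → ∣ t ∣ ℚ.≤ 1ℚ ℚ.+ ∣ x N ∣) (split (x n) (x N))
        (ℚ.≤-trans (ℚ.∣p+q∣≤∣p∣+∣q∣ (x n ℚ.- x N) (x N))
          (ℚ.+-monoˡ-≤ ∣ x N ∣ (close n N N≤n ℕ.≤-refl)))
    where
    open +-*-Solver
    split : ∀ p q → (p ℚ.- q) ℚ.+ q ≡ p
    split = solve 2 (λ p q → (p :- q) :+ q := p) refl

  +-cauchy : ∀ {x y} → IsCauchy x → IsCauchy y → IsCauchy (λ n → x n ℚ.+ y n)
  +-cauchy {x} {y} cx cy ε 0<ε
    with M , hx ← cx (½ ℚ.* ε) (½-pos 0<ε)
       | N , hy ← cy (½ ℚ.* ε) (½-pos 0<ε) =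
    M ℕ.⊔ N , λ m n m≥ n≥ →
      subst (λ t → ∣ t ∣ ℚ.≤ ε) (sym (rearrange (x m) (y m) (x n) (y n)))
        (ℚ.≤-trans (ℚ.∣p+q∣≤∣p∣+∣q∣ (x m ℚ.- x n) (y m ℚ.- y n))
          (subst (_ ℚ.≤_) (halves ε)
            (ℚ.+-mono-≤
              (hx m n (ℕ.m⊔n≤o⇒m≤o M N m≥) (ℕ.m⊔n≤o⇒m≤o M N n≥))
              (hy m n (ℕ.m⊔n≤o⇒n≤o M N m≥) (ℕ.m⊔n≤o⇒n≤o M N n≥)))))
    where
    open +-*-Solver
    rearrange : ∀ a b c d → (a ℚ.+ b) ℚ.- (c ℚ.+ d) ≡ (a ℚ.- c) ℚ.+ (b ℚ.- d)
    rearrange = solve 4 (λ a b c d → (a :+ b) :- (c :+ d) := (a :- c) :+ (b :- d)) refl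

  neg-cauchy : ∀ {x} → IsCauchy x → IsCauchy (λ n → ℚ.- x n)
  neg-cauchy {x} cx ε 0<ε with N , hx ← cx ε 0<ε =
    N , λ m n m≥ n≥ → subst (ℚ._≤ ε)
      (trans (sym (ℚ.∣-p∣≡∣p∣ (x m ℚ.- x n))) (cong ∣_∣ (rearrange (x m) (x n))))
      (hx m n m≥ n≥)
    where
    open +-*-Solver
    rearrange : ∀ a b → ℚ.- (a ℚ.- b) ≡ (ℚ.- a) ℚ.- (ℚ.- b)
    rearrange = solve 2 (λ a b → :- (a :- b) := (:- a) :- (:- b)) refl

  quotient : ∀ {B ε} → 0ℚ ℚ.< B → 0ℚ ℚ.< ε → ∃ λ δ → 0ℚ ℚ.< δ × B ℚ.* δ ≡ ε
  quotient {B} {ε} 0<B 0<ε = B⁻¹ ℚ.* ε , *-pos {B⁻¹} {ε} 0<B⁻¹ 0<ε , (begin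
    B ℚ.* (B⁻¹ ℚ.* ε)  ≡⟨ ℚ.*-assoc B B⁻¹ ε ⟨
    (B ℚ.* B⁻¹) ℚ.* ε  ≡⟨ cong (ℚ._* ε) (ℚ.*-inverseʳ B {{B≢0}}) ⟩
    1ℚ ℚ.* ε           ≡⟨ ℚ.*-identityˡ ε ⟩
    ε                  ∎)
    where
    open ≡-Reasoning
    B≢0 : ℚ.NonZero B
    B≢0 = ℚ.pos⇒nonZero B {{ℚ.positive 0<B}}
    B⁻¹ : ℚ
    B⁻¹ = (ℚ.1/ B) {{B≢0}}
    0<B⁻¹ : 0ℚ ℚ.< B⁻¹
    0<B⁻¹ = ℚ.positive⁻¹ B⁻¹ {{ℚ.1/pos⇒pos B {{ℚ.positive 0<B}}}}

  product-close : ∀ {a b c d B C δ γ} ε → 0ℚ ℚ.≤ B → 0ℚ ℚ.≤ C →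
                  B ℚ.* δ ≡ ½ ℚ.* ε → C ℚ.* γ ≡ ½ ℚ.* ε →
                  ∣ a ∣ ℚ.≤ B → ∣ b ℚ.- d ∣ ℚ.≤ δ → ∣ d ∣ ℚ.≤ C → ∣ a ℚ.- c ∣ ℚ.≤ γ →
                  ∣ a ℚ.* b ℚ.- c ℚ.* d ∣ ℚ.≤ ε
  product-close {a} {b} {c} {d} {B} {C} {δ} {γ} ε 0≤B 0≤C Bδ Cγ a≤ bd≤ d≤ ac≤ = begin
    ∣ a ℚ.* b ℚ.- c ℚ.* d ∣                      ≡⟨ cong ∣_∣ (rearrange a b c d) ⟩
    ∣ a ℚ.* (b ℚ.- d) ℚ.+ d ℚ.* (a ℚ.- c) ∣      ≤⟨ ℚ.∣p+q∣≤∣p∣+∣q∣ (a ℚ.* (b ℚ.- d)) (d ℚ.* (a ℚ.- c)) ⟩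
    ∣ a ℚ.* (b ℚ.- d) ∣ ℚ.+ ∣ d ℚ.* (a ℚ.- c) ∣  ≤⟨ ℚ.+-mono-≤
      (∣*∣≤ {a} {b ℚ.- d} {B} {δ} {½ ℚ.* ε} 0≤B Bδ a≤ bd≤)
      (∣*∣≤ {d} {a ℚ.- c} {C} {γ} {½ ℚ.* ε} 0≤C Cγ d≤ ac≤) ⟩
    ½ ℚ.* ε ℚ.+ ½ ℚ.* ε                          ≡⟨ halves ε ⟩
    ε                                            ∎
    where
    open ℚ.≤-Reasoning
    open +-*-Solver
    rearrange : ∀ a b c d → a ℚ.* b ℚ.- c ℚ.* d ≡ a ℚ.* (b ℚ.- d) ℚ.+ d ℚ.* (a ℚ.- c)
    rearrange = solve 4
      (λ a b c d → a :* b :- c :* d := a :* (b :- d) :+ d :* (a :- c)) refl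

  *-cauchy : ∀ {x y} → IsCauchy x → IsCauchy y → IsCauchy (λ n → x n ℚ.* y n)
  *-cauchy {x} {y} cx cy ε 0<ε = combine (bounded {x} cx) (bounded {y} cy)
    where
    Bounded : (ℕ → ℚ) → Set
    Bounded z = ∃ λ B → 0ℚ ℚ.< B × ∃ λ N → ∀ n → N ℕ.≤ n → ∣ z n ∣ ℚ.≤ B

    Close : (ℕ → ℚ) → ℚ → Set
    Close z δ = ∃ λ N → ∀ m n → N ℕ.≤ m → N ℕ.≤ n → ∣ z m ℚ.- z n ∣ ℚ.≤ δ

    merge : ∀ {B C δ γ} → 0ℚ ℚ.≤ B → 0ℚ ℚ.≤ C →
            B ℚ.* δ ≡ ½ ℚ.* ε → C ℚ.* γ ≡ ½ ℚ.* ε →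
            (∃ λ N → ∀ n → N ℕ.≤ n → ∣ x n ∣ ℚ.≤ B) →
            (∃ λ N → ∀ n → N ℕ.≤ n → ∣ y n ∣ ℚ.≤ C) →
            Close x γ → Close y δ → Close (λ n → x n ℚ.* y n) ε
    merge {B} {C} {δ} {γ} 0≤B 0≤C Bδ Cγ (N₁ , bx) (N₂ , by) (N₃ , hx) (N₄ , hy) =
      (N₁ ℕ.⊔ N₂) ℕ.⊔ (N₃ ℕ.⊔ N₄) , λ m n m≥ n≥ →
        product-close {x m} {y m} {x n} {y n} {B} {C} {δ} {γ} ε 0≤B 0≤C Bδ Cγ
          (bx m (ℕ.m⊔n≤o⇒m≤o N₁ N₂ (l m≥)))
          (hy m n (ℕ.m⊔n≤o⇒n≤o N₃ N₄ (r m≥)) (ℕ.m⊔n≤o⇒n≤o N₃ N₄ (r n≥)))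
          (by n (ℕ.m⊔n≤o⇒n≤o N₁ N₂ (l n≥)))
          (hx m n (ℕ.m⊔n≤o⇒m≤o N₃ N₄ (r m≥)) (ℕ.m⊔n≤o⇒m≤o N₃ N₄ (r n≥)))
      where
      l : ∀ {k} → (N₁ ℕ.⊔ N₂) ℕ.⊔ (N₃ ℕ.⊔ N₄) ℕ.≤ k → N₁ ℕ.⊔ N₂ ℕ.≤ k
      l = ℕ.m⊔n≤o⇒m≤o (N₁ ℕ.⊔ N₂) (N₃ ℕ.⊔ N₄)
      r : ∀ {k} → (N₁ ℕ.⊔ N₂) ℕ.⊔ (N₃ ℕ.⊔ N₄) ℕ.≤ k → N₃ ℕ.⊔ N₄ ℕ.≤ k
      r = ℕ.m⊔n≤o⇒n≤o (N₁ ℕ.⊔ N₂) (N₃ ℕ.⊔ N₄)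

    combine : Bounded x → Bounded y → Close (λ n → x n ℚ.* y n) ε
    combine (B , 0<B , bx) (C , 0<C , by) =
      let δ , 0<δ , Bδ = quotient {B} {½ ℚ.* ε} 0<B (½-pos {ε} 0<ε)
          γ , 0<γ , Cγ = quotient {C} {½ ℚ.* ε} 0<C (½-pos {ε} 0<ε)
      in merge {B} {C} {δ} {γ} (ℚ.<⇒≤ 0<B) (ℚ.<⇒≤ 0<C) Bδ Cγ bx by (cx γ 0<γ) (cy δ 0<δ)

  const-cauchy : ∀ c → IsCauchy (λ _ → c)
  const-cauchy c ε 0<ε = 0 , λ _ _ _ _ → ∣0∣≤ (ℚ.+-inverseʳ c) 0<ε

fromℚ : ℚ → ℝ
fromℚ c = mkℝ (λ _ → c) (const-cauchy c)

0ℝ 1ℝ : ℝ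
0ℝ = fromℚ 0ℚ
1ℝ = fromℚ 1ℚ

infixl 6 _+_ _-_
infixl 7 _*_
infix  8 -_

_+_ _*_ : ℝ → ℝ → ℝ
x + y = mkℝ (λ n → seq x n ℚ.+ seq y n) (+-cauchy {seq x} {seq y} (cauchy x) (cauchy y))
x * y = mkℝ (λ n → seq x n ℚ.* seq y n) (*-cauchy {seq x} {seq y} (cauchy x) (cauchy y))

-_ : ℝ → ℝ
- x = mkℝ (λ n → ℚ.- seq x n) (neg-cauchy {seq x} (cauchy x))

_-_ : ℝ → ℝ → ℝ
x - y = x + (- y)

∑ ∏ : ∀ {n} → Vector ℝ n → ℝ
∑ = Vector.foldr _+_ 0ℝ
∏ = Vector.foldr _*_ 1ℝ

listSum : List ℝ → ℝ
listSum = List.foldr _+_ 0ℝ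

-- The value at [] is a dummy.
mean : List ℝ → ℝ
mean []          = 0ℝ
mean xs@(_ ∷ ys) = fromℚ (+ 1 / suc (length ys)) * listSum xs

-- The diagonal w i i is the intrinsic weight of buyer i and is not
-- constrained by the edge relation.
record SocialNetwork (n : ℕ) : Set₁ where
  field
    Edge     : Fin n → Fin n → Set
    w        : Fin n → Fin n → ℝ
    w-nonneg : ∀ i j → 0ℝ ≤ w i j
    w-sym    : ∀ i j → i ≢ j → w i j ≃ w j i
    w-pos    : ∀ i j → i ≢ j → Edge i j ⇔ 0ℝ < w i j

-- `order ⟨$⟩ʳ i` is the position of buyer i.
record Strategy (n : ℕ) : Set where
  field
    order  : Permutation′ n
    prob   : Vector ℝ n
    prob≥½ : ∀ i → fromℚ ½ ≤ prob i
    prob≤1 : ∀ i → prob i ≤ 1ℝ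

revenue : ∀ {n} → SocialNetwork n → Permutation′ n → Vector ℝ n → ℝ
revenue G π p =
  ∑ λ i → (p i * (1ℝ - p i)) *
    (w i i + ∑ λ j → if does ((π ⟨$⟩ʳ j) Fin.<? (π ⟨$⟩ʳ i)) then p j * w j i else 0ℝ)
  where open SocialNetwork G

strategyRevenue : ∀ {n} → SocialNetwork n → Strategy n → ℝ
strategyRevenue G s = revenue G (Strategy.order s) (Strategy.prob s)

IsMaxRevenue : ∀ {n} → SocialNetwork n → ℝ → Set
IsMaxRevenue G M =
  (∃ λ s → strategyRevenue G s ≃ M) × (∀ s → strategyRevenue G s ≤ M)

-- r is at least c times the maximum revenue.  That the maximum is attained
-- by real pricing probabilities is a compactness fact which is not
-- available constructively, so the bound is also required against every
-- single strategy; this keeps it from being vacuous.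
ApproximatesMaxRevenue : ∀ {n} → SocialNetwork n → ℝ → ℝ → Set
ApproximatesMaxRevenue G c r =
  (∀ s → c * strategyRevenue G s ≤ r) × (∀ M → IsMaxRevenue G M → c * M ≤ r)

-- Every permutation (up to pointwise equality) occurs exactly once: 0 is
-- sent to each position j, the others to the remaining positions.
permutations : ∀ n → List (Permutation′ n)
permutations zero    = id ∷ []
permutations (suc n) =
  concatMap (λ j → map (insert Fin.zero j) (permutations n)) (allFin (suc n))

assignments : ∀ K n → List (Vector (Fin K) n)
assignments K zero    = Vector.[] ∷ []
assignments K (suc n) =
  concatMap (λ k → map (k Vector.∷_) (assignments K n)) (allFin K)

Respects : ∀ {K n} → Vector (Fin K) n → Permutation′ n → Set
Respects a π = ∀ i j → a i Fin.< a j → (π ⟨$⟩ʳ i) Fin.< (π ⟨$⟩ʳ j)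

respects? : ∀ {K n} (a : Vector (Fin K) n) π → Dec (Respects a π)
respects? a π = all? λ i → all? λ j →
  (a i Fin.<? a j) →-dec ((π ⟨$⟩ʳ i) Fin.<? (π ⟨$⟩ʳ j))

-- Classes are numbered from 0 here, so toℕ k plays the role of k - 1 in
-- 1 - (k - 1) / (2 (K - 1)).
classProb : ∀ {K} .{{_ : NonTrivial K}} → Fin K → ℝ
classProb {K} k = 1ℝ - fromℚ ((+ toℕ k / (2 ℕ.* (K ℕ.∸ 1))) {{denominator≢0}})
  where
  denominator≢0 : NonZero (2 ℕ.* (K ℕ.∸ 1))
  denominator≢0 = ℕ.m*n≢0 2 (K ℕ.∸ 1)
    {{_}} {{ℕ.>-nonZero (ℕ.m<n⇒0<n∸m (ℕ.nonTrivial⇒n>1 K))}}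

record IE (K : ℕ) .{{_ : NonTrivial K}} : Set where
  field
    assignProb        : Vector ℝ K
    assignProb-nonneg : ∀ k → 0ℝ ≤ assignProb k
    assignProb-sum    : ∑ assignProb ≃ 1ℝ

-- Independent uniform orders inside the classes, concatenated in class
-- order, amount to a uniform choice among the permutations that respect
-- the class order.
expectedRevenue : ∀ {K n} .{{_ : NonTrivial K}} → IE K → SocialNetwork n → ℝ
expectedRevenue {K} {n} S G =
  listSum (map (λ a → ∏ (assignProb ∘ a) * meanRevenue a) (assignments K n))
  where
  open IE S
  meanRevenue : Vector (Fin K) n → ℝ
  meanRevenue a =
    mean (map (λ π → revenue G π (classProb ∘ a)) (filter (respects? a) (permutations n)))

q₆ : Vector ℚ 6
q₆ = Vector.fromList
  (+ 183 / 1000 ∷ + 75 / 1000 ∷ + 75 / 1000 ∷ + 175 / 1000 ∷ + 261 / 1000 ∷ + 231 / 1000 ∷ [])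

ie₆ : IE 6
ie₆ = record
  { assignProb        = fromℚ ∘ q₆
  ; assignProb-nonneg = λ k → mk≤ λ ε 0<ε → 0 , λ _ _ →
      ℚ.+-mono-≤ (q₆-nonneg k) (ℚ.<⇒≤ 0<ε)
  ; assignProb-sum    = mk≃ λ ε 0<ε → 0 , λ _ _ → ∣0∣≤ refl 0<ε
  }
  where
  q₆-nonneg : ∀ k → 0ℚ ℚ.≤ q₆ k
  q₆-nonneg = toWitness {a? = all? λ k → 0ℚ ℚ.≤? q₆ k} _

{-# OPTIONS --safe #-}

-- Both revenues are linear in the weights.  From a buyer i any strategy gets
-- at most w i i / 4, and from a pair i, j at most w i j / 4, since only the
-- later of the two pays for the edge and p * p' * (1 - p') ≤ 1 / 4 for
-- probabilities p, p'.  The IE strategy gets exactly β * w i i and α * w i j in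
-- expectation: given the classes of i and j, their order is either forced by
-- the classes or irrelevant because the prices agree.  For ie₆ one has
-- 4 α = 0.7032… and 4 β = 0.7035….

module Submission where

open import Defs
open import Data.Integer using (+_)
open import Data.Nat using (ℕ)
open import Data.Rational using (_/_)

open import Algebra.Bundles using (CommutativeRing)
open import Data.Bool using (true; false; if_then_else_)
open import Data.Fin as Fin using (Fin; zero; suc; punchIn)
open import Data.Fin.Permutation as Perm
  using (Permutation′; insert; _⟨$⟩ʳ_; _⟨$⟩ˡ_; inverseˡ; inverseʳ; insert-punchIn)
import Data.Fin.Properties as Fin
import Data.Integer as ℤ
import Data.Integer.Properties as ℤ
open import Data.List as List using (List; []; _∷_; _++_; allFin; concatMap; filter; length; map)
open import Data.List.Membership.Propositional using (_∈_; find; lose)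
open import Data.List.Membership.Propositional.Properties using (∈-allFin; ∈-filter⁺; ∈-filter⁻)
open import Data.List.Properties using (length-map)
open import Data.List.Relation.Unary.Any as Any using (Any; here; there)
import Data.List.Relation.Unary.Any.Properties as Any
open import Data.Nat as ℕ using (zero; suc; z≤n; s≤s; NonTrivial)
import Data.Nat.Properties as ℕ
open import Data.Product using (∃; _×_; _,_; proj₁; proj₂)
open import Data.Rational as ℚ using (ℚ; 0ℚ; 1ℚ; ½; ∣_∣; toℚᵘ; fromℚᵘ)
import Data.Rational.Properties as ℚ
open import Data.Rational.Solver using (module +-*-Solver)
open import Data.Rational.Unnormalised as ℚᵘ using (mkℚᵘ; *≡*)
import Data.Rational.Unnormalised.Properties as ℚᵘ
open import Data.Sum using (inj₁; inj₂)
open import Data.Vec.Functional as Vector using (Vector)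
open import Function using (_∘_)
open import Relation.Binary.Definitions using (tri<; tri≈; tri>)
open import Relation.Binary.PropositionalEquality
  using (_≡_; _≢_; refl; sym; trans; cong; cong₂; subst; subst₂; module ≡-Reasoning)
open import Relation.Nullary using (¬_; yes; no; contradiction)
open import Relation.Nullary.Decidable using (does; dec-true; dec-false; toWitness)
open import Relation.Unary using (Decidable)
open import Algebra.Properties.Semiring.Sum (CommutativeRing.semiring ℚ.+-*-commutativeRing)
  using (sum; sum-cong-≗; ∑-distrib-+; ∑-comm; *-distribˡ-sum; *-distribʳ-sum)

-- Real operations act pointwise on Cauchy sequences, so algebraic identities can be proved in ℚ at
-- each index `m`, where the IE coefficients, built from constant sequences, are exact rationals.
-- What may fail termwise are the hypotheses: at a finite index a pricing probability may leave
-- [1/2, 1], a weight may be negative and `w` may be asymmetric. Instead, the gap between the IE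
-- revenue and the scaled revenue of a strategy is written as a combination of reals that are
-- nonnegative in the limit, and closure of nonnegativity under sums and products does the rest. A
-- second delicate point is that an empty list has mean 0 by convention: averaging an
-- order-independent quantity returns it only because every class assignment admits a compatible
-- order.

private variable
  A B : Set
  n : ℕ

-- Order and scaling in the rationals

*-nonneg : ∀ {p q} → 0ℚ ℚ.≤ p → 0ℚ ℚ.≤ q → 0ℚ ℚ.≤ p ℚ.* q
*-nonneg {p} {q} 0≤p 0≤q = ℚ.nonNegative⁻¹ (p ℚ.* q)
  {{ℚ.nonNeg*nonNeg⇒nonNeg p {{ℚ.nonNegative 0≤p}} q {{ℚ.nonNegative 0≤q}}}}

p≤∣p∣ : ∀ p → p ℚ.≤ ∣ p ∣
p≤∣p∣ p with ℚ.≤-total 0ℚ p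
... | inj₁ 0≤p = ℚ.≤-reflexive (sym (ℚ.0≤p⇒∣p∣≡p 0≤p))
... | inj₂ p≤0 = ℚ.≤-trans p≤0 (ℚ.0≤∣p∣ p)

p≤q⇒0≤q-p : ∀ {p q} → p ℚ.≤ q → 0ℚ ℚ.≤ q ℚ.- p
p≤q⇒0≤q-p {p} {q} p≤q = subst (ℚ._≤ q ℚ.- p) (ℚ.+-inverseʳ p) (ℚ.+-monoˡ-≤ (ℚ.- p) p≤q)

0≤q-p⇒p≤q : ∀ {p q} → 0ℚ ℚ.≤ q ℚ.- p → p ℚ.≤ q
0≤q-p⇒p≤q {p} {q} 0≤ = subst₂ ℚ._≤_ (ℚ.+-identityˡ p) (cancel p q) (ℚ.+-monoˡ-≤ p 0≤)
  where
  open +-*-Solver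
  cancel : ∀ p q → (q ℚ.- p) ℚ.+ p ≡ q
  cancel = solve 2 (λ p q → (q :- p) :+ p := q) refl

0≤p*p : ∀ p → 0ℚ ℚ.≤ p ℚ.* p
0≤p*p p with ℚ.≤-total 0ℚ p
... | inj₁ 0≤p = *-nonneg 0≤p 0≤p
... | inj₂ p≤0 = subst (0ℚ ℚ.≤_) (neg² p) (*-nonneg 0≤-p 0≤-p)
  where
  open +-*-Solver
  0≤-p = ℚ.neg-antimono-≤ p≤0
  neg² : ∀ p → ℚ.- p ℚ.* ℚ.- p ≡ p ℚ.* p
  neg² = solve 1 (λ p → (:- p) :* (:- p) := p :* p) refl

∣p∣≤q⇒0≤p+q : ∀ {p q} → ∣ p ∣ ℚ.≤ q → 0ℚ ℚ.≤ p ℚ.+ q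
∣p∣≤q⇒0≤p+q {p} {q} ∣p∣≤q = subst (ℚ._≤ p ℚ.+ q) (ℚ.+-inverseʳ p)
  (ℚ.+-monoʳ-≤ p (ℚ.≤-trans (p≤∣p∣ (ℚ.- p)) (subst (ℚ._≤ q) (sym (ℚ.∣-p∣≡∣p∣ p)) ∣p∣≤q)))

positive-scale : ∀ {B ε} → 0ℚ ℚ.< B → 0ℚ ℚ.< ε → ∃ λ δ → 0ℚ ℚ.< δ × B ℚ.* δ ≡ ε
positive-scale {B} {ε} 0<B 0<ε = ε ℚ.* B⁻¹ , ℚ.positive⁻¹ (ε ℚ.* B⁻¹) {{pos}} , (begin
  B ℚ.* (ε ℚ.* B⁻¹)  ≡⟨ ℚ.*-comm B (ε ℚ.* B⁻¹) ⟩
  ε ℚ.* B⁻¹ ℚ.* B    ≡⟨ ℚ.*-assoc ε B⁻¹ B ⟩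
  ε ℚ.* (B⁻¹ ℚ.* B)  ≡⟨ cong (ε ℚ.*_) (ℚ.*-inverseˡ B) ⟩
  ε ℚ.* 1ℚ           ≡⟨ ℚ.*-identityʳ ε ⟩
  ε                  ∎)
  where
  open ≡-Reasoning
  instance
    B-pos = ℚ.positive 0<B
    B-nonZero = ℚ.pos⇒nonZero B
  B⁻¹ = ℚ.1/ B
  pos = ℚ.pos*pos⇒pos ε {{ℚ.positive 0<ε}} B⁻¹ {{ℚ.1/pos⇒pos B}}

-- Nonnegative real numbers

Eventually : (ℕ → Set) → Set
Eventually P = ∃ λ N → ∀ n → N ℕ.≤ n → P n

Eventually-map₂ : ∀ {P Q R : ℕ → Set} → (∀ n → P n → Q n → R n) →
                  Eventually P → Eventually Q → Eventually R
Eventually-map₂ f (M , p) (N , q) = M ℕ.⊔ N , λ n n≥ →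
  f n (p n (ℕ.m⊔n≤o⇒m≤o M N n≥)) (q n (ℕ.m⊔n≤o⇒n≤o M N n≥))

Eventually-map : ∀ {P Q : ℕ → Set} → (∀ n → P n → Q n) → Eventually P → Eventually Q
Eventually-map f (N , p) = N , λ n n≥ → f n (p n n≥)

bounded : ∀ x → ∃ λ B → 0ℚ ℚ.< B × Eventually (λ n → ∣ seq x n ∣ ℚ.≤ B)
bounded x with N , close ← cauchy x 1ℚ (ℚ.positive⁻¹ 1ℚ) =
  1ℚ ℚ.+ ∣ seq x N ∣ ,
  ℚ.+-mono-<-≤ (ℚ.positive⁻¹ 1ℚ) (ℚ.0≤∣p∣ (seq x N)) ,
  N , λ n n≥ → begin
    ∣ seq x n ∣                            ≡⟨ cong ∣_∣ (split (seq x n) (seq x N)) ⟩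
    ∣ (seq x n ℚ.- seq x N) ℚ.+ seq x N ∣  ≤⟨ ℚ.∣p+q∣≤∣p∣+∣q∣ (seq x n ℚ.- seq x N) (seq x N) ⟩
    ∣ seq x n ℚ.- seq x N ∣ ℚ.+ ∣ seq x N ∣ ≤⟨ ℚ.+-monoˡ-≤ ∣ seq x N ∣ (close n N n≥ ℕ.≤-refl) ⟩
    1ℚ ℚ.+ ∣ seq x N ∣                     ∎
  where
  open ℚ.≤-Reasoning
  open +-*-Solver
  split : ∀ p q → p ≡ (p ℚ.- q) ℚ.+ q
  split = solve 2 (λ p q → p := (p :- q) :+ q) refl

halves : ∀ ε → ½ ℚ.* ε ℚ.+ ½ ℚ.* ε ≡ ε
halves ε = trans (sym (ℚ.*-distribʳ-+ ε ½ ½)) (ℚ.*-identityˡ ε)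

½-pos : ∀ {ε} → 0ℚ ℚ.< ε → 0ℚ ℚ.< ½ ℚ.* ε
½-pos {ε} 0<ε = ℚ.positive⁻¹ (½ ℚ.* ε) {{ℚ.pos*pos⇒pos ½ ε {{ℚ.positive 0<ε}}}}

-- Besides dropping nonnegative terms, this transports nonnegativity between reals whose sequences
-- agree termwise, where propositional equality of the reals is not to be had.
nonneg-mono : ∀ {x y} → (∀ n → seq x n ℚ.≤ seq y n) → 0ℝ ≤ x → 0ℝ ≤ y
nonneg-mono x≤y 0≤x = mk≤ λ ε 0<ε →
  Eventually-map (λ n h → ℚ.≤-trans h (ℚ.+-monoˡ-≤ ε (x≤y n))) (un≤ 0≤x ε 0<ε)

nonneg-pointwise : ∀ {x} → (∀ n → 0ℚ ℚ.≤ seq x n) → 0ℝ ≤ x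
nonneg-pointwise 0≤x = mk≤ λ ε 0<ε → 0 , λ n _ → ℚ.+-mono-≤ (0≤x n) (ℚ.<⇒≤ 0<ε)

nonneg-+ : ∀ {x y} → 0ℝ ≤ x → 0ℝ ≤ y → 0ℝ ≤ x + y
nonneg-+ {x} {y} 0≤x 0≤y = mk≤ λ ε 0<ε →
  Eventually-map₂
    (λ n hx hy → subst (0ℚ ℚ.≤_) (regroup (seq x n) (seq y n) ε) (ℚ.+-mono-≤ hx hy))
    (un≤ 0≤x (½ ℚ.* ε) (½-pos 0<ε)) (un≤ 0≤y (½ ℚ.* ε) (½-pos 0<ε))
  where
  open +-*-Solver
  interchange : ∀ a b c → (a ℚ.+ c) ℚ.+ (b ℚ.+ c) ≡ (a ℚ.+ b) ℚ.+ (c ℚ.+ c)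
  interchange = solve 3 (λ a b c → (a :+ c) :+ (b :+ c) := (a :+ b) :+ (c :+ c)) refl
  regroup : ∀ a b ε → (a ℚ.+ ½ ℚ.* ε) ℚ.+ (b ℚ.+ ½ ℚ.* ε) ≡ (a ℚ.+ b) ℚ.+ ε
  regroup a b ε = trans (interchange a b (½ ℚ.* ε)) (cong (a ℚ.+ b ℚ.+_) (halves ε))

nonneg-∑ : ∀ {n} {f : Vector ℝ n} → (∀ i → 0ℝ ≤ f i) → 0ℝ ≤ ∑ f
nonneg-∑ {zero}  0≤f = nonneg-pointwise λ _ → ℚ.≤-refl
nonneg-∑ {suc n} 0≤f = nonneg-+ (0≤f zero) (nonneg-∑ λ i → 0≤f (suc i))

-- Eventually x + δ, y + γ, B - x and C - y are all nonnegative, and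
-- x y + (B + δ) γ + C δ = (x + δ) (y + γ) + γ (B - x) + δ (C - y).
nonneg-* : ∀ {x y} → 0ℝ ≤ x → 0ℝ ≤ y → 0ℝ ≤ x * y
nonneg-* {x} {y} 0≤x 0≤y = mk≤ λ ε 0<ε →
  let C , 0<C , y≤C = bounded y
      B , 0<B , x≤B = bounded x
      δ , 0<δ , Cδ  = positive-scale 0<C (½-pos 0<ε)
      0<B+δ         = ℚ.+-mono-< 0<B 0<δ
      γ , 0<γ , B′γ = positive-scale 0<B+δ (½-pos 0<ε)
  in Eventually-map₂
       (λ n (hx , hy) (x≤ , y≤) →
         subst (0ℚ ℚ.≤_)
           (trans (expand (seq x n) (seq y n) B C δ γ)
             (cong (seq x n ℚ.* seq y n ℚ.+_) (trans (cong₂ ℚ._+_ B′γ Cδ) (halves ε))))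
           (ℚ.+-mono-≤
             (ℚ.+-mono-≤ (*-nonneg hx hy)
               (*-nonneg (ℚ.<⇒≤ 0<γ) (p≤q⇒0≤q-p (ℚ.≤-trans (p≤∣p∣ (seq x n)) x≤))))
             (*-nonneg (ℚ.<⇒≤ 0<δ) (p≤q⇒0≤q-p (ℚ.≤-trans (p≤∣p∣ (seq y n)) y≤)))))
       (Eventually-map₂ (λ _ → _,_) (un≤ 0≤x δ 0<δ) (un≤ 0≤y γ 0<γ))
       (Eventually-map₂ (λ _ → _,_) x≤B y≤C)
  where
  open +-*-Solver
  expand : ∀ x y B C δ γ →
           ((x ℚ.+ δ) ℚ.* (y ℚ.+ γ) ℚ.+ γ ℚ.* (B ℚ.- x)) ℚ.+ δ ℚ.* (C ℚ.- y) ≡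
           x ℚ.* y ℚ.+ ((B ℚ.+ δ) ℚ.* γ ℚ.+ C ℚ.* δ)
  expand = solve 6 (λ x y B C δ γ →
    ((x :+ δ) :* (y :+ γ) :+ γ :* (B :- x)) :+ δ :* (C :- y) :=
    x :* y :+ ((B :+ δ) :* γ :+ C :* δ)) refl

-- The factor `c` may have either sign: it is eventually bounded, so its product with a null
-- sequence is null. This absorbs both the asymmetry of approximate weights and the passage from an
-- optimal strategy to the maximum.
≃⇒nonneg-*-diff : ∀ c {x y} → x ≃ y → 0ℝ ≤ c * (x - y)
≃⇒nonneg-*-diff c {x} {y} x≃y = mk≤ λ ε 0<ε →
  let B , 0<B , c≤B = bounded c
      δ , 0<δ , Bδ  = positive-scale 0<B 0<ε
  in Eventually-map₂
       (λ n c≤ d≤ → ∣p∣≤q⇒0≤p+q (bound (ℚ.<⇒≤ 0<B) Bδ c≤ d≤))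
       c≤B (un≃ x≃y δ 0<δ)
  where
  open ℚ.≤-Reasoning
  bound : ∀ {p q B δ ε} → 0ℚ ℚ.≤ B → B ℚ.* δ ≡ ε → ∣ p ∣ ℚ.≤ B → ∣ q ∣ ℚ.≤ δ →
          ∣ p ℚ.* q ∣ ℚ.≤ ε
  bound {p} {q} {B} {δ} {ε} 0≤B Bδ p≤ q≤ = begin
    ∣ p ℚ.* q ∣      ≡⟨ ℚ.∣p*q∣≡∣p∣*∣q∣ p q ⟩
    ∣ p ∣ ℚ.* ∣ q ∣  ≤⟨ ℚ.*-monoʳ-≤-nonNeg ∣ q ∣ {{ℚ.nonNegative (ℚ.0≤∣p∣ q)}} p≤ ⟩
    B ℚ.* ∣ q ∣      ≤⟨ ℚ.*-monoˡ-≤-nonNeg B {{ℚ.nonNegative 0≤B}} q≤ ⟩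
    B ℚ.* δ          ≡⟨ Bδ ⟩
    ε                ∎

≤⇒nonneg-diff : ∀ {x y} → x ≤ y → 0ℝ ≤ y - x
≤⇒nonneg-diff {x} {y} x≤y = mk≤ λ ε 0<ε →
  Eventually-map (λ n h → subst (0ℚ ℚ.≤_) (swap (seq x n) (seq y n) ε) (p≤q⇒0≤q-p h))
    (un≤ x≤y ε 0<ε)
  where
  open +-*-Solver
  swap : ∀ x y ε → (y ℚ.+ ε) ℚ.- x ≡ (y ℚ.- x) ℚ.+ ε
  swap = solve 3 (λ x y ε → (y :+ ε) :- x := (y :- x) :+ ε) refl

nonneg-diff⇒≤ : ∀ {x y} → 0ℝ ≤ y - x → x ≤ y
nonneg-diff⇒≤ {x} {y} 0≤ = mk≤ λ ε 0<ε →
  Eventually-map (λ n h → 0≤q-p⇒p≤q (subst (0ℚ ℚ.≤_) (swap (seq x n) (seq y n) ε) h))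
    (un≤ 0≤ ε 0<ε)
  where
  open +-*-Solver
  swap : ∀ x y ε → (y ℚ.- x) ℚ.+ ε ≡ (y ℚ.+ ε) ℚ.- x
  swap = solve 3 (λ x y ε → (y :- x) :+ ε := (y :+ ε) :- x) refl

-- Permutations respecting a class assignment

punchIn-mono-< : ∀ {n} i {j k : Fin n} → j Fin.< k → punchIn i j Fin.< punchIn i k
punchIn-mono-< i {j} {k} j<k =
  ℕ.≰⇒> λ k≤j → ℕ.<⇒≱ j<k (Fin.punchIn-cancel-≤ i k j k≤j)

-- A downward closed `P` is an initial segment, and `j` is its length. Inserting a new element at
-- position `j` puts it after exactly the elements of that segment.
threshold : ∀ {n} {P : Fin n → Set} → Decidable P → (∀ {x y} → x Fin.≤ y → P y → P x) →
            ∃ λ j → ∀ x → (P x → punchIn j x Fin.< j) × (¬ P x → j Fin.< punchIn j x)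
threshold {zero}  P? closed = zero , λ ()
threshold {suc n} P? closed with P? zero
... | no ¬P0 = zero , λ x → (λ Px → contradiction (closed z≤n Px) ¬P0) , λ _ → s≤s z≤n
... | yes P0 with j , below ← threshold (P? ∘ suc) (closed ∘ s≤s) = suc j , λ where
  zero    → (λ _ → s≤s z≤n) , λ ¬P0 → contradiction P0 ¬P0
  (suc x) → (λ Px → s≤s (proj₁ (below x) Px)) , λ ¬Px → s≤s (proj₂ (below x) ¬Px)

-- The new buyer goes directly behind all buyers of strictly smaller class. Since `π` already
-- respects the classes, these occupy an initial segment of positions, so `threshold` applies.
insertion-respects : ∀ {K n} (a : Vector (Fin K) (suc n)) π → Respects (a ∘ suc) π →
                     ∃ λ j → Respects a (insert zero j π)
insertion-respects {K} {n} a π respects = j , λ where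
      zero    zero    lt → contradiction lt (ℕ.<-irrefl refl)
      zero    (suc t) lt → subst (j Fin.<_) (sym (shifted t))
        (proj₂ (below _) λ lt′ → ℕ.<-asym lt (subst (λ u → a (suc u) Fin.< a zero) (inverseˡ π) lt′))
      (suc s) zero    lt → subst (Fin._< j) (sym (shifted s))
        (proj₁ (below _) (subst (λ u → a (suc u) Fin.< a zero) (sym (inverseˡ π)) lt))
      (suc s) (suc t) lt → subst₂ Fin._<_ (sym (shifted s)) (sym (shifted t))
        (punchIn-mono-< j (respects s t lt))
  where
  Earlier : Fin n → Set
  Earlier x = a (suc (π ⟨$⟩ˡ x)) Fin.< a zero

  closed : ∀ {x y} → x Fin.≤ y → Earlier y → Earlier x
  closed x≤y y<0 = ℕ.≰⇒> λ 0≤x → ℕ.<⇒≱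
    (subst₂ Fin._<_ (inverseʳ π) (inverseʳ π) (respects _ _ (ℕ.<-≤-trans y<0 0≤x))) x≤y

  position = threshold {P = Earlier} (λ _ → _ Fin.<? _) closed
  j = proj₁ position
  below = proj₂ position

  shifted : ∀ t → insert zero j π ⟨$⟩ʳ suc t ≡ punchIn j (π ⟨$⟩ʳ t)
  shifted = insert-punchIn zero j π

-- Guarantees that the list over which the orders are averaged is nonempty, so that the dummy value
-- of the mean never enters.
respecting-permutation : ∀ {K n} (a : Vector (Fin K) n) → Any (Respects a) (permutations n)
respecting-permutation {n = zero}  a = Any.here λ ()
respecting-permutation {n = suc n} a
  with π , π∈ , respects ← find (respecting-permutation (a ∘ suc))
  with j , respects′ ← insertion-respects a π respects =
  Any.concatMap⁺ _ (lose (∈-allFin j) (Any.map⁺ (lose π∈ respects′)))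

-- Averages over lists

-- Normalised fractions do not compute when a numerator or denominator is a variable, so arithmetic
-- with a symbolic list length is done on unnormalised ones.
fromℚᵘ-homo-+ : ∀ p q → fromℚᵘ p ℚ.+ fromℚᵘ q ≡ fromℚᵘ (p ℚᵘ.+ q)
fromℚᵘ-homo-+ p q = ℚ.toℚᵘ-injective (begin
  toℚᵘ (fromℚᵘ p ℚ.+ fromℚᵘ q)            ≈⟨ ℚ.toℚᵘ-homo-+ (fromℚᵘ p) (fromℚᵘ q) ⟩
  toℚᵘ (fromℚᵘ p) ℚᵘ.+ toℚᵘ (fromℚᵘ q)  ≈⟨ ℚᵘ.+-cong (ℚ.toℚᵘ-fromℚᵘ p) (ℚ.toℚᵘ-fromℚᵘ q) ⟩
  p ℚᵘ.+ q                               ≈⟨ ℚ.toℚᵘ-fromℚᵘ (p ℚᵘ.+ q) ⟨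
  toℚᵘ (fromℚᵘ (p ℚᵘ.+ q))               ∎)
  where open ℚᵘ.≃-Reasoning

fromℚᵘ-homo-* : ∀ p q → fromℚᵘ p ℚ.* fromℚᵘ q ≡ fromℚᵘ (p ℚᵘ.* q)
fromℚᵘ-homo-* p q = ℚ.toℚᵘ-injective (begin
  toℚᵘ (fromℚᵘ p ℚ.* fromℚᵘ q)            ≈⟨ ℚ.toℚᵘ-homo-* (fromℚᵘ p) (fromℚᵘ q) ⟩
  toℚᵘ (fromℚᵘ p) ℚᵘ.* toℚᵘ (fromℚᵘ q)  ≈⟨ ℚᵘ.*-cong (ℚ.toℚᵘ-fromℚᵘ p) (ℚ.toℚᵘ-fromℚᵘ q) ⟩
  p ℚᵘ.* q                               ≈⟨ ℚ.toℚᵘ-fromℚᵘ (p ℚᵘ.* q) ⟨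
  toℚᵘ (fromℚᵘ (p ℚᵘ.* q))               ∎)
  where open ℚᵘ.≃-Reasoning

fromℕ : ℕ → ℚ
-- The second argument of `mkℚᵘ` is the denominator minus one, so this is n / 1.
fromℕ n = fromℚᵘ (mkℚᵘ (+ n) 0)

fromℕ-suc : ∀ n → 1ℚ ℚ.+ fromℕ n ≡ fromℕ (suc n)
fromℕ-suc n = trans (fromℚᵘ-homo-+ ℚᵘ.1ℚᵘ (mkℚᵘ (+ n) 0))
  (cong (λ k → fromℚᵘ (mkℚᵘ (+ 1 ℤ.+ k) 0)) (ℤ.*-identityʳ (+ n)))

1/n*n≡1 : ∀ n → + 1 / suc n ℚ.* fromℕ (suc n) ≡ 1ℚ
1/n*n≡1 n = trans (fromℚᵘ-homo-* (mkℚᵘ (+ 1) n) (mkℚᵘ (+ suc n) 0))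
  (ℚ.fromℚᵘ-cong {mkℚᵘ (+ 1) n ℚᵘ.* mkℚᵘ (+ suc n) 0} {ℚᵘ.1ℚᵘ}
    (*≡* (trans (ℤ.*-identityʳ (+ 1 ℤ.* + suc n))
    (cong (λ k → + 1 ℤ.* + k) (sym (ℕ.*-identityʳ (suc n)))))))

sumOver : List A → (A → ℚ) → ℚ
sumOver xs f = List.foldr (λ x s → f x ℚ.+ s) 0ℚ xs

sumOver-cong : ∀ (xs : List A) {f g} → (∀ {x} → x ∈ xs → f x ≡ g x) → sumOver xs f ≡ sumOver xs g
sumOver-cong []       f≡g = refl
sumOver-cong (x ∷ xs) f≡g = cong₂ ℚ._+_ (f≡g (here refl)) (sumOver-cong xs (f≡g ∘ there))

sumOver-+ : ∀ (xs : List A) f g → sumOver xs (λ x → f x ℚ.+ g x) ≡ sumOver xs f ℚ.+ sumOver xs g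
sumOver-+ []       f g = refl
sumOver-+ (x ∷ xs) f g = trans (cong (f x ℚ.+ g x ℚ.+_) (sumOver-+ xs f g))
  (interchange (f x) (g x) (sumOver xs f) (sumOver xs g))
  where
  open +-*-Solver
  interchange : ∀ a b c d → (a ℚ.+ b) ℚ.+ (c ℚ.+ d) ≡ (a ℚ.+ c) ℚ.+ (b ℚ.+ d)
  interchange = solve 4 (λ a b c d → (a :+ b) :+ (c :+ d) := (a :+ c) :+ (b :+ d)) refl

sumOver-*ʳ : ∀ (xs : List A) f c → sumOver xs (λ x → f x ℚ.* c) ≡ sumOver xs f ℚ.* c
sumOver-*ʳ []       f c = sym (ℚ.*-zeroˡ c)
sumOver-*ʳ (x ∷ xs) f c = trans (cong (f x ℚ.* c ℚ.+_) (sumOver-*ʳ xs f c))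
  (sym (ℚ.*-distribʳ-+ c (f x) (sumOver xs f)))

sumOver-*ˡ : ∀ (xs : List A) c f → sumOver xs (λ x → c ℚ.* f x) ≡ c ℚ.* sumOver xs f
sumOver-*ˡ []       c f = sym (ℚ.*-zeroʳ c)
sumOver-*ˡ (x ∷ xs) c f = trans (cong (c ℚ.* f x ℚ.+_) (sumOver-*ˡ xs c f))
  (sym (ℚ.*-distribˡ-+ c (f x) (sumOver xs f)))

sumOver-const : ∀ (xs : List A) c → sumOver xs (λ _ → c) ≡ fromℕ (length xs) ℚ.* c
sumOver-const []       c = sym (ℚ.*-zeroˡ c)
sumOver-const (x ∷ xs) c = begin
  c ℚ.+ sumOver xs (λ _ → c)             ≡⟨ cong (c ℚ.+_) (sumOver-const xs c) ⟩
  c ℚ.+ fromℕ (length xs) ℚ.* c          ≡⟨ factor c (fromℕ (length xs)) ⟩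
  (1ℚ ℚ.+ fromℕ (length xs)) ℚ.* c       ≡⟨ cong (ℚ._* c) (fromℕ-suc (length xs)) ⟩
  fromℕ (suc (length xs)) ℚ.* c          ∎
  where
  open ≡-Reasoning
  open +-*-Solver
  factor : ∀ c k → c ℚ.+ k ℚ.* c ≡ (1ℚ ℚ.+ k) ℚ.* c
  factor = solve 2 (λ c k → c :+ k :* c := (con 1ℚ :+ k) :* c) refl

sumOver-map : ∀ (h : A → B) xs f → sumOver (map h xs) f ≡ sumOver xs (f ∘ h)
sumOver-map h []       f = refl
sumOver-map h (x ∷ xs) f = cong (f (h x) ℚ.+_) (sumOver-map h xs f)

sumOver-++ : ∀ (xs ys : List A) f → sumOver (xs ++ ys) f ≡ sumOver xs f ℚ.+ sumOver ys f
sumOver-++ []       ys f = sym (ℚ.+-identityˡ (sumOver ys f))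
sumOver-++ (x ∷ xs) ys f = trans (cong (f x ℚ.+_) (sumOver-++ xs ys f))
  (sym (ℚ.+-assoc (f x) (sumOver xs f) (sumOver ys f)))

sumOver-concatMap : ∀ (h : A → List B) xs f →
                    sumOver (concatMap h xs) f ≡ sumOver xs (λ x → sumOver (h x) f)
sumOver-concatMap h []       f = refl
sumOver-concatMap h (x ∷ xs) f = trans (sumOver-++ (h x) (concatMap h xs) f)
  (cong (sumOver (h x) f ℚ.+_) (sumOver-concatMap h xs f))

sumOver-tabulate : ∀ {n} (h : Fin n → A) f → sumOver (List.tabulate h) f ≡ sum (f ∘ h)
sumOver-tabulate {n = zero}  h f = refl
sumOver-tabulate {n = suc n} h f = cong (f (h zero) ℚ.+_) (sumOver-tabulate (h ∘ suc) f)

-- The value at 0 is a dummy, chosen to make the mean of the empty list 0.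
recip : ℕ → ℚ
recip zero    = 0ℚ
recip (suc n) = + 1 / suc n

average : List A → (A → ℚ) → ℚ
average xs f = recip (length xs) ℚ.* sumOver xs f

average-+ : ∀ (xs : List A) f g → average xs (λ x → f x ℚ.+ g x) ≡ average xs f ℚ.+ average xs g
average-+ xs f g = trans (cong (recip (length xs) ℚ.*_) (sumOver-+ xs f g))
  (ℚ.*-distribˡ-+ (recip (length xs)) (sumOver xs f) (sumOver xs g))

average-*ʳ : ∀ (xs : List A) f c → average xs (λ x → f x ℚ.* c) ≡ average xs f ℚ.* c
average-*ʳ xs f c = trans (cong (recip (length xs) ℚ.*_) (sumOver-*ʳ xs f c))
  (sym (ℚ.*-assoc (recip (length xs)) (sumOver xs f) c))

average-const : ∀ {x} (xs : List A) c → x ∈ xs → average xs (λ _ → c) ≡ c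
average-const xs@(_ ∷ ys) c _ = begin
  average xs (λ _ → c)                                ≡⟨ cong (recip (length xs) ℚ.*_) (sumOver-const xs c) ⟩
  recip (length xs) ℚ.* (fromℕ (length xs) ℚ.* c)   ≡⟨ ℚ.*-assoc (recip (length xs)) (fromℕ (length xs)) c ⟨
  recip (length xs) ℚ.* fromℕ (length xs) ℚ.* c     ≡⟨ cong (ℚ._* c) (1/n*n≡1 (length ys)) ⟩
  1ℚ ℚ.* c                                            ≡⟨ ℚ.*-identityˡ c ⟩
  c                                                   ∎
  where open ≡-Reasoning

product : ∀ {n} → Vector ℚ n → ℚ
product = Vector.foldr ℚ._*_ 1ℚ

-- Expectation over assignments and orders

module Expectation {K} (q : Fin K → ℚ) (q-sum : sum q ≡ 1ℚ) where

  weight : ∀ {n} → Vector (Fin K) n → ℚ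
  weight a = product (q ∘ a)

  expectedValue : ∀ {n} → (Vector (Fin K) n → ℚ) → ℚ
  expectedValue {n} f = sumOver (assignments K n) λ a → weight a ℚ.* f a

  -- Conditioning on the class of buyer 0, which is independent of the others. The marginals below
  -- follow by induction along this recursion.
  expectedValue-suc : ∀ {n} (f : Vector (Fin K) (suc n) → ℚ) →
    expectedValue f ≡ sum λ k → q k ℚ.* expectedValue (λ a → f (k Vector.∷ a))
  expectedValue-suc {n} f = begin
    sumOver (concatMap (λ k → map (k Vector.∷_) (assignments K n)) (allFin K)) g
      ≡⟨ sumOver-concatMap _ (allFin K) g ⟩
    sumOver (allFin K) (λ k → sumOver (map (k Vector.∷_) (assignments K n)) g)
      ≡⟨ sumOver-tabulate {n = K} (λ k → k) (λ k → sumOver (map (k Vector.∷_) (assignments K n)) g) ⟩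
    sum (λ k → sumOver (map (k Vector.∷_) (assignments K n)) g)
      ≡⟨ sum-cong-≗ {K} step ⟩
    sum (λ k → q k ℚ.* expectedValue (λ a → f (k Vector.∷ a)))
      ∎
    where
    open ≡-Reasoning
    g : Vector (Fin K) (suc n) → ℚ
    g a = weight a ℚ.* f a
    step : ∀ k → sumOver (map (k Vector.∷_) (assignments K n)) g ≡
                 q k ℚ.* expectedValue (λ a → f (k Vector.∷ a))
    step k = begin
      sumOver (map (k Vector.∷_) (assignments K n)) g
        ≡⟨ sumOver-map (k Vector.∷_) (assignments K n) g ⟩
      sumOver (assignments K n) (λ a → q k ℚ.* weight a ℚ.* f (k Vector.∷ a))
        ≡⟨ sumOver-cong (assignments K n) (λ {a} _ → ℚ.*-assoc (q k) (weight a) (f (k Vector.∷ a))) ⟩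
      sumOver (assignments K n) (λ a → q k ℚ.* (weight a ℚ.* f (k Vector.∷ a)))
        ≡⟨ sumOver-*ˡ (assignments K n) (q k) _ ⟩
      q k ℚ.* expectedValue (λ a → f (k Vector.∷ a))
        ∎

  sum-q* : ∀ c → sum (λ k → q k ℚ.* c) ≡ c
  sum-q* c = trans (sym (*-distribʳ-sum c q)) (trans (cong (ℚ._* c) q-sum) (ℚ.*-identityˡ c))

  expectedValue-const : ∀ n c → expectedValue {n} (λ _ → c) ≡ c
  expectedValue-const zero    c = trans (ℚ.+-identityʳ (1ℚ ℚ.* c)) (ℚ.*-identityˡ c)
  expectedValue-const (suc n) c = trans (expectedValue-suc {n} (λ _ → c))
    (trans (sum-cong-≗ {K} λ k → cong (q k ℚ.*_) (expectedValue-const n c)) (sum-q* c))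

  expectedValue-single : ∀ {n} (h : Fin K → ℚ) (i : Fin n) →
    expectedValue (λ a → h (a i)) ≡ sum λ k → q k ℚ.* h k
  expectedValue-single {suc n} h zero    = trans (expectedValue-suc {n} (λ a → h (a zero)))
    (sum-cong-≗ {K} λ k → cong (q k ℚ.*_) (expectedValue-const n (h k)))
  expectedValue-single {suc n} h (suc i) = trans (expectedValue-suc {n} (λ a → h (a (suc i))))
    (trans (sum-cong-≗ {K} λ k → cong (q k ℚ.*_) (expectedValue-single h i)) (sum-q* _))

  expectedValue-pair : ∀ {n} (h : Fin K → Fin K → ℚ) (i j : Fin n) → i ≢ j →
    expectedValue (λ a → h (a i) (a j)) ≡ sum λ k → q k ℚ.* sum λ l → q l ℚ.* h k l
  expectedValue-pair {suc n} h zero zero i≢j = contradiction refl i≢j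
  expectedValue-pair {suc n} h zero (suc j) i≢j = trans
    (expectedValue-suc {n} (λ a → h (a zero) (a (suc j))))
    (sum-cong-≗ {K} λ k → cong (q k ℚ.*_) (expectedValue-single (h k) j))
  -- Buyer 0 is now the second argument, so the recursion puts the sum over `l` outside and the two
  -- sums must be exchanged.
  expectedValue-pair {suc n} h (suc i) zero i≢j = begin
    expectedValue (λ a → h (a (suc i)) (a zero))
      ≡⟨ expectedValue-suc {n} (λ a → h (a (suc i)) (a zero)) ⟩
    sum (λ l → q l ℚ.* expectedValue (λ a → h (a i) l))
      ≡⟨ sum-cong-≗ {K} (λ l → trans (cong (q l ℚ.*_) (expectedValue-single (λ k → h k l) i))
                                 (*-distribˡ-sum (q l) (λ k → q k ℚ.* h k l))) ⟩
    sum (λ l → sum λ k → q l ℚ.* (q k ℚ.* h k l))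
      ≡⟨ ∑-comm (λ l k → q l ℚ.* (q k ℚ.* h k l)) ⟩
    sum (λ k → sum λ l → q l ℚ.* (q k ℚ.* h k l))
      ≡⟨ sum-cong-≗ {K} (λ k → trans (sum-cong-≗ {K} λ l → swap (q l) (q k) (h k l))
                                 (sym (*-distribˡ-sum (q k) (λ l → q l ℚ.* h k l)))) ⟩
    sum (λ k → q k ℚ.* sum λ l → q l ℚ.* h k l)
      ∎
    where
    open ≡-Reasoning
    open +-*-Solver
    swap : ∀ a b c → a ℚ.* (b ℚ.* c) ≡ b ℚ.* (a ℚ.* c)
    swap = solve 3 (λ a b c → a :* (b :* c) := b :* (a :* c)) refl
  expectedValue-pair {suc n} h (suc i) (suc j) i≢j = trans
    (expectedValue-suc {n} (λ a → h (a (suc i)) (a (suc j))))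
    (trans (sum-cong-≗ {K} λ k → cong (q k ℚ.*_) (expectedValue-pair h i j (i≢j ∘ cong suc)))
      (sum-q* _))

  respecting : ∀ {n} → Vector (Fin K) n → List (Permutation′ n)
  respecting {n} a = filter (respects? a) (permutations n)

  𝔼 : ∀ {n} → (Vector (Fin K) n → Permutation′ n → ℚ) → ℚ
  𝔼 φ = expectedValue λ a → average (respecting a) (φ a)

  -- Agreement is required only on compatible orders; this is how the class order enters the
  -- computation of expectations.
  𝔼-cong : ∀ {n} {φ ψ : Vector (Fin K) n → Permutation′ n → ℚ} →
           (∀ a π → Respects a π → φ a π ≡ ψ a π) → 𝔼 φ ≡ 𝔼 ψ
  𝔼-cong {n} φ≡ψ = sumOver-cong (assignments K n) λ {a} _ →
    cong (λ s → weight a ℚ.* (recip (length (respecting a)) ℚ.* s))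
      (sumOver-cong (respecting a) λ {π} π∈ →
        φ≡ψ a π (proj₂ (∈-filter⁻ (respects? a) {xs = permutations n} π∈)))

  𝔼-+ : ∀ {n} (φ ψ : Vector (Fin K) n → Permutation′ n → ℚ) →
        𝔼 (λ a π → φ a π ℚ.+ ψ a π) ≡ 𝔼 φ ℚ.+ 𝔼 ψ
  𝔼-+ {n} φ ψ = trans
    (sumOver-cong (assignments K n) λ {a} _ → trans
      (cong (weight a ℚ.*_) (average-+ (respecting a) (φ a) (ψ a)))
      (ℚ.*-distribˡ-+ (weight a) (average (respecting a) (φ a)) (average (respecting a) (ψ a))))
    (sumOver-+ (assignments K n)
      (λ a → weight a ℚ.* average (respecting a) (φ a))
      (λ a → weight a ℚ.* average (respecting a) (ψ a)))

  𝔼-*ʳ : ∀ {n} (φ : Vector (Fin K) n → Permutation′ n → ℚ) c →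
         𝔼 (λ a π → φ a π ℚ.* c) ≡ 𝔼 φ ℚ.* c
  𝔼-*ʳ {n} φ c = trans
    (sumOver-cong (assignments K n) λ {a} _ → trans
      (cong (weight a ℚ.*_) (average-*ʳ (respecting a) (φ a) c))
      (sym (ℚ.*-assoc (weight a) (average (respecting a) (φ a)) c)))
    (sumOver-*ʳ (assignments K n) (λ a → weight a ℚ.* average (respecting a) (φ a)) c)

  𝔼-class : ∀ {n} (f : Vector (Fin K) n → ℚ) → 𝔼 (λ a _ → f a) ≡ expectedValue f
  𝔼-class {n} f = sumOver-cong (assignments K n) λ {a} _ →
    let π , π∈ , respects = find (respecting-permutation a) in
    cong (weight a ℚ.*_) (average-const (respecting a) (f a) (∈-filter⁺ (respects? a) π∈ respects))

  𝔼-const : ∀ {n} c → 𝔼 {n} (λ _ _ → c) ≡ c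
  𝔼-const {n} c = trans (𝔼-class {n} (λ _ → c)) (expectedValue-const n c)

  𝔼-sum : ∀ {n m} (φ : Fin m → Vector (Fin K) n → Permutation′ n → ℚ) →
          𝔼 (λ a π → sum λ i → φ i a π) ≡ sum λ i → 𝔼 (φ i)
  𝔼-sum {n} {zero}  φ = 𝔼-const {n} 0ℚ
  𝔼-sum {n} {suc m} φ = trans (𝔼-+ (φ zero) (λ a π → sum λ i → φ (suc i) a π))
    (cong (𝔼 (φ zero) ℚ.+_) (𝔼-sum (φ ∘ suc)))

-- Revenue as a linear form in the weights

¼ : ℚ
¼ = + 1 / 4

myopic : ℚ → ℚ
myopic p = p ℚ.* (1ℚ ℚ.- p)

-- The difference is the square of ½ - p. As this holds for every rational, it applies to each
-- approximant of a probability, even one outside [0, 1].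
myopic≤¼ : ∀ p → myopic p ℚ.≤ ¼
myopic≤¼ p = 0≤q-p⇒p≤q (subst (0ℚ ℚ.≤_) (sym (square p)) (0≤p*p (½ ℚ.- p)))
  where
  open +-*-Solver
  square : ∀ p → ¼ ℚ.- p ℚ.* (1ℚ ℚ.- p) ≡ (½ ℚ.- p) ℚ.* (½ ℚ.- p)
  square = solve 1 (λ p → con ¼ :- p :* (con 1ℚ :- p) := (con ½ :- p) :* (con ½ :- p)) refl

before : Permutation′ n → Fin n → Fin n → ℚ
before π j i = if does ((π ⟨$⟩ʳ j) Fin.<? (π ⟨$⟩ʳ i)) then 1ℚ else 0ℚ

before≡1 : ∀ (π : Permutation′ n) {i j} → (π ⟨$⟩ʳ j) Fin.< (π ⟨$⟩ʳ i) → before π j i ≡ 1ℚ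
before≡1 π lt = cong (if_then 1ℚ else 0ℚ) (dec-true (_ Fin.<? _) lt)

before≡0 : ∀ (π : Permutation′ n) {i j} → ¬ (π ⟨$⟩ʳ j) Fin.< (π ⟨$⟩ʳ i) → before π j i ≡ 0ℚ
before≡0 π ≮ = cong (if_then 1ℚ else 0ℚ) (dec-false (_ Fin.<? _) ≮)

-- The coefficient of `w j i` in the revenue: `i` is the buyer who pays, `j` the one approached
-- earlier.
influence : Permutation′ n → Vector ℚ n → Fin n → Fin n → ℚ
influence π p i j = myopic (p i) ℚ.* (before π j i ℚ.* p j)

⟨$⟩ʳ-injective : ∀ (π : Permutation′ n) {i j} → π ⟨$⟩ʳ i ≡ π ⟨$⟩ʳ j → i ≡ j
⟨$⟩ʳ-injective π πi≡πj =
  trans (sym (Perm.inverseˡ π)) (trans (cong (π Perm.⟨$⟩ˡ_) πi≡πj) (Perm.inverseˡ π))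

influence-before : ∀ (π : Permutation′ n) p {i j} → (π ⟨$⟩ʳ j) Fin.< (π ⟨$⟩ʳ i) →
                   influence π p i j ≡ myopic (p i) ℚ.* p j
influence-before π p {i} {j} lt = cong (myopic (p i) ℚ.*_)
  (trans (cong (ℚ._* p j) (before≡1 π lt)) (ℚ.*-identityˡ (p j)))

influence-after : ∀ (π : Permutation′ n) p {i j} → ¬ (π ⟨$⟩ʳ j) Fin.< (π ⟨$⟩ʳ i) →
                  influence π p i j ≡ 0ℚ
influence-after π p {i} {j} ≮ =
  trans (cong (myopic (p i) ℚ.*_) (trans (cong (ℚ._* p j) (before≡0 π ≮)) (ℚ.*-zeroˡ (p j))))
    (ℚ.*-zeroʳ (myopic (p i)))

-- The double sum includes i = j. The pair coefficients in use vanish there, which leaves the loops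
-- to `g`.
linear : (Fin n → ℚ) → (Fin n → Fin n → ℚ) → (Fin n → Fin n → ℚ) → ℚ
linear g c w = sum (λ i → g i ℚ.* w i i) ℚ.+ sum λ i → sum λ j → c i j ℚ.* w j i

difference-+ : ∀ κ a b s t → (a ℚ.- κ ℚ.* b) ℚ.+ (s ℚ.- κ ℚ.* t) ≡ (a ℚ.+ s) ℚ.- κ ℚ.* (b ℚ.+ t)
difference-+ = solve 5 (λ κ a b s t →
  (a :- κ :* b) :+ (s :- κ :* t) := (a :+ s) :- κ :* (b :+ t)) refl
  where open +-*-Solver

sum-difference : ∀ κ (f g : Vector ℚ n) → sum (λ i → f i ℚ.- κ ℚ.* g i) ≡ sum f ℚ.- κ ℚ.* sum g
sum-difference {zero}  κ f g = sym (trans (ℚ.+-identityˡ (ℚ.- (κ ℚ.* 0ℚ))) (cong ℚ.-_ (ℚ.*-zeroʳ κ)))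
sum-difference {suc n} κ f g = trans
  (cong (f zero ℚ.- κ ℚ.* g zero ℚ.+_) (sum-difference κ (f ∘ suc) (g ∘ suc)))
  (difference-+ κ (f zero) (g zero) (sum (f ∘ suc)) (sum (g ∘ suc)))

linear-difference : ∀ κ {g g′} {c c′} (w : Fin n → Fin n → ℚ) →
  linear (λ i → g i ℚ.- κ ℚ.* g′ i) (λ i j → c i j ℚ.- κ ℚ.* c′ i j) w ≡
  linear g c w ℚ.- κ ℚ.* linear g′ c′ w
linear-difference {n} κ {g} {g′} {c} {c′} w = trans
  (cong₂ ℚ._+_ loops pairs)
  (difference-+ κ (sum λ i → g i ℚ.* w i i) (sum λ i → g′ i ℚ.* w i i)
    (sum λ i → sum λ j → c i j ℚ.* w j i) (sum λ i → sum λ j → c′ i j ℚ.* w j i))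
  where
  open +-*-Solver
  distrib : ∀ κ a b w → (a ℚ.- κ ℚ.* b) ℚ.* w ≡ a ℚ.* w ℚ.- κ ℚ.* (b ℚ.* w)
  distrib = solve 4 (λ κ a b w → (a :- κ :* b) :* w := a :* w :- κ :* (b :* w)) refl

  loops : (sum λ i → (g i ℚ.- κ ℚ.* g′ i) ℚ.* w i i) ≡
          (sum λ i → g i ℚ.* w i i) ℚ.- κ ℚ.* (sum λ i → g′ i ℚ.* w i i)
  loops = trans (sum-cong-≗ {n} λ i → distrib κ (g i) (g′ i) (w i i))
    (sum-difference κ (λ i → g i ℚ.* w i i) (λ i → g′ i ℚ.* w i i))

  pairs : (sum λ i → sum λ j → (c i j ℚ.- κ ℚ.* c′ i j) ℚ.* w j i) ≡
          (sum λ i → sum λ j → c i j ℚ.* w j i) ℚ.- κ ℚ.* (sum λ i → sum λ j → c′ i j ℚ.* w j i)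
  pairs = trans
    (sum-cong-≗ {n} λ i → trans
      (sum-cong-≗ {n} λ j → distrib κ (c i j) (c′ i j) (w j i))
      (sum-difference κ (λ j → c i j ℚ.* w j i) (λ j → c′ i j ℚ.* w j i)))
    (sum-difference κ (λ i → sum λ j → c i j ℚ.* w j i) (λ i → sum λ j → c′ i j ℚ.* w j i))

-- For symmetric real weights the correction c i j * (w j i - w i j) is zero,
-- but their rational approximants are symmetric only in the limit.
linear-symmetrised : ∀ g c (w : Fin n → Fin n → ℚ) →
  sum (λ i → g i ℚ.* w i i) ℚ.+
    (sum λ i → sum λ j → ½ ℚ.* ((c i j ℚ.+ c j i) ℚ.* w i j ℚ.+ c i j ℚ.* (w j i ℚ.- w i j))) ≡
  linear g c w
linear-symmetrised {n} g c w = cong (sum (λ i → g i ℚ.* w i i) ℚ.+_) (begin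
  (sum λ i → sum λ j → ½ ℚ.* ((c i j ℚ.+ c j i) ℚ.* w i j ℚ.+ c i j ℚ.* (w j i ℚ.- w i j)))
    ≡⟨ (sum-cong-≗ {n} λ i → trans
         (sum-cong-≗ {n} λ j → simplify (c i j) (c j i) (w i j) (w j i))
         (∑-distrib-+ (λ j → t i j) (λ j → t j i))) ⟩
  (sum λ i → (sum λ j → t i j) ℚ.+ (sum λ j → t j i))
    ≡⟨ ∑-distrib-+ (λ i → sum λ j → t i j) (λ i → sum λ j → t j i) ⟩
  (sum λ i → sum λ j → t i j) ℚ.+ (sum λ i → sum λ j → t j i)
    ≡⟨ cong ((sum λ i → sum λ j → t i j) ℚ.+_) (∑-comm (λ i j → t j i)) ⟩
  (sum λ i → sum λ j → t i j) ℚ.+ (sum λ i → sum λ j → t i j)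
    ≡⟨ ∑-distrib-+ (λ i → sum λ j → t i j) (λ i → sum λ j → t i j) ⟨
  (sum λ i → (sum λ j → t i j) ℚ.+ (sum λ j → t i j))
    ≡⟨ (sum-cong-≗ {n} λ i → trans (sym (∑-distrib-+ (t i) (t i)))
         (sum-cong-≗ {n} λ j → halves (c i j ℚ.* w j i))) ⟩
  (sum λ i → sum λ j → c i j ℚ.* w j i) ∎)
  where
  open ≡-Reasoning
  t : Fin n → Fin n → ℚ
  t i j = ½ ℚ.* (c i j ℚ.* w j i)
  open +-*-Solver
  simplify : ∀ a b u v → ½ ℚ.* ((a ℚ.+ b) ℚ.* u ℚ.+ a ℚ.* (v ℚ.- u)) ≡
                         ½ ℚ.* (a ℚ.* v) ℚ.+ ½ ℚ.* (b ℚ.* u)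
  simplify = solve 4 (λ a b u v → con ½ :* ((a :+ b) :* u :+ a :* (v :- u)) :=
                                  con ½ :* (a :* v) :+ con ½ :* (b :* u)) refl

-- Rational terms of real sums, products and means

seq-∑ : ∀ m (f : Vector ℝ n) → seq (∑ f) m ≡ sum λ i → seq (f i) m
seq-∑ {zero}  m f = refl
seq-∑ {suc n} m f = cong (seq (f zero) m ℚ.+_) (seq-∑ m (f ∘ suc))

seq-∑∑ : ∀ m (f : Fin n → Vector ℝ n) →
         seq (∑ λ i → ∑ (f i)) m ≡ sum λ i → sum λ j → seq (f i j) m
seq-∑∑ {n} m f = trans (seq-∑ m (λ i → ∑ (f i))) (sum-cong-≗ {n} λ i → seq-∑ m (f i))

seq-∏ : ∀ m (f : Vector ℝ n) → seq (∏ f) m ≡ product λ i → seq (f i) m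
seq-∏ {zero}  m f = refl
seq-∏ {suc n} m f = cong (seq (f zero) m ℚ.*_) (seq-∏ m (f ∘ suc))

seq-listSum : ∀ m (f : A → ℝ) xs → seq (listSum (map f xs)) m ≡ sumOver xs λ x → seq (f x) m
seq-listSum m f []       = refl
seq-listSum m f (x ∷ xs) = cong (seq (f x) m ℚ.+_) (seq-listSum m f xs)

seq-mean : ∀ m (f : A → ℝ) xs → seq (mean (map f xs)) m ≡ average xs λ x → seq (f x) m
seq-mean m f []       = refl
seq-mean m f (x ∷ xs) =
  cong₂ ℚ._*_ (cong (λ k → + 1 / suc k) (length-map f xs)) (seq-listSum m f (x ∷ xs))

module _ (G : SocialNetwork n) where
  open SocialNetwork G

  revenue-linear : ∀ π p m {pₘ : Vector ℚ n} → (∀ i → seq (p i) m ≡ pₘ i) →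
    seq (revenue G π p) m ≡
    linear (λ i → myopic (pₘ i)) (influence π pₘ) (λ i j → seq (w i j) m)
  revenue-linear π p m {pₘ} p≡pₘ = trans (seq-∑ m λ i → (p i * (1ℝ - p i)) * (w i i + ∑ (offer i)))
    (trans (sum-cong-≗ {n} λ i → trans
        (cong (λ x → myopic x ℚ.* (wₘ i i ℚ.+ seq (∑ (offer i)) m)) (p≡pₘ i)) (step i))
      (∑-distrib-+ {n} (λ i → myopic (pₘ i) ℚ.* wₘ i i)
        (λ i → sum λ j → influence π pₘ i j ℚ.* wₘ j i)))
    where
    open ≡-Reasoning
    wₘ : Fin n → Fin n → ℚ
    wₘ i j = seq (w i j) m
    offer : Fin n → Fin n → ℝ
    offer i j = if does ((π ⟨$⟩ʳ j) Fin.<? (π ⟨$⟩ʳ i)) then p j * w j i else 0ℝ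

    seq-offer : ∀ i j → seq (offer i j) m ≡ before π j i ℚ.* pₘ j ℚ.* wₘ j i
    seq-offer i j with does ((π ⟨$⟩ʳ j) Fin.<? (π ⟨$⟩ʳ i))
    ... | true  = cong (ℚ._* wₘ j i) (trans (p≡pₘ j) (sym (ℚ.*-identityˡ (pₘ j))))
    ... | false = sym (trans (cong (ℚ._* wₘ j i) (ℚ.*-zeroˡ (pₘ j))) (ℚ.*-zeroˡ (wₘ j i)))

    step : ∀ i → myopic (pₘ i) ℚ.* (wₘ i i ℚ.+ seq (∑ (offer i)) m) ≡
                 myopic (pₘ i) ℚ.* wₘ i i ℚ.+ sum λ j → influence π pₘ i j ℚ.* wₘ j i
    step i = begin
      myopic (pₘ i) ℚ.* (wₘ i i ℚ.+ seq (∑ (offer i)) m)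
        ≡⟨ ℚ.*-distribˡ-+ (myopic (pₘ i)) (wₘ i i) (seq (∑ (offer i)) m) ⟩
      myopic (pₘ i) ℚ.* wₘ i i ℚ.+ myopic (pₘ i) ℚ.* seq (∑ (offer i)) m
        ≡⟨ cong (myopic (pₘ i) ℚ.* wₘ i i ℚ.+_) (begin
             myopic (pₘ i) ℚ.* seq (∑ (offer i)) m
               ≡⟨ cong (myopic (pₘ i) ℚ.*_) (trans (seq-∑ m (offer i)) (sum-cong-≗ {n} (seq-offer i))) ⟩
             (myopic (pₘ i) ℚ.* sum λ j → before π j i ℚ.* pₘ j ℚ.* wₘ j i)
               ≡⟨ *-distribˡ-sum {n} (myopic (pₘ i)) (λ j → before π j i ℚ.* pₘ j ℚ.* wₘ j i) ⟩
             (sum λ j → myopic (pₘ i) ℚ.* (before π j i ℚ.* pₘ j ℚ.* wₘ j i))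
               ≡⟨ (sum-cong-≗ {n} λ j →
                    sym (ℚ.*-assoc (myopic (pₘ i)) (before π j i ℚ.* pₘ j) (wₘ j i))) ⟩
             (sum λ j → influence π pₘ i j ℚ.* wₘ j i) ∎) ⟩
      myopic (pₘ i) ℚ.* wₘ i i ℚ.+ (sum λ j → influence π pₘ i j ℚ.* wₘ j i)
        ∎

  -- By symmetry of the weights only the combined coefficient of an unordered pair needs a sign. The
  -- witness is the symmetrised form, whose summands are visibly nonnegative reals; its terms equal
  -- those of the original form exactly.
  linear-nonneg : ∀ (g : Vector ℝ n) (c : Fin n → Fin n → ℝ) →
    (∀ i → 0ℝ ≤ g i) → (∀ i j → 0ℝ ≤ c i j + c j i) →
    ∃ λ x → 0ℝ ≤ x ×
      ∀ m → seq x m ≡ linear (λ i → seq (g i) m) (λ i j → seq (c i j) m) (λ i j → seq (w i j) m)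
  linear-nonneg g c 0≤g 0≤c =
    (∑ λ i → g i * w i i) + (∑ λ i → ∑ (pair i)) ,
    nonneg-+ (nonneg-∑ λ i → nonneg-* (0≤g i) (w-nonneg i i))
      (nonneg-∑ λ i → nonneg-∑ λ j → nonneg-* {fromℚ ½} (nonneg-pointwise λ _ → ℚ.nonNegative⁻¹ ½)
        (nonneg-+ (nonneg-* (0≤c i j) (w-nonneg i j)) (cross i j))) ,
    λ m → trans (cong₂ ℚ._+_ (seq-∑ m λ i → g i * w i i) (seq-∑∑ m pair))
      (linear-symmetrised (λ i → seq (g i) m) (λ i j → seq (c i j) m) (λ i j → seq (w i j) m))
    where
    pair : Fin n → Fin n → ℝ
    pair i j = fromℚ ½ * ((c i j + c j i) * w i j + c i j * (w j i - w i j))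

    -- Off the diagonal the difference of weights tends to 0; on it, where `w-sym` says nothing, the
    -- difference cancels termwise.
    cross : ∀ i j → 0ℝ ≤ c i j * (w j i - w i j)
    cross i j with i Fin.≟ j
    ... | no  i≢j  = ≃⇒nonneg-*-diff (c i j) (w-sym j i (i≢j ∘ sym))
    ... | yes refl = nonneg-pointwise λ m → ℚ.≤-reflexive (sym (trans
      (cong (seq (c i i) m ℚ.*_) (ℚ.+-inverseʳ (seq (w i i) m))) (ℚ.*-zeroʳ (seq (c i i) m))))

scaled-myopic≤ : ∀ {κ γ} → 0ℚ ℚ.≤ κ → κ ℚ.* ¼ ℚ.≤ γ → ∀ p → κ ℚ.* myopic p ℚ.≤ γ
scaled-myopic≤ {κ} 0≤κ κ¼≤γ p =
  ℚ.≤-trans (ℚ.*-monoˡ-≤-nonNeg κ {{ℚ.nonNegative 0≤κ}} (myopic≤¼ p)) κ¼≤γ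

-- Comparison with an arbitrary strategy

module Surplus {κ β α : ℚ} (0≤κ : 0ℚ ℚ.≤ κ) (κ¼≤β : κ ℚ.* ¼ ℚ.≤ β) (κ¼≤α : κ ℚ.* ¼ ℚ.≤ α)
  (e : Fin n → Fin n → ℚ) (e-pair : ∀ {i j} → i ≢ j → e i j ℚ.+ e j i ≡ α)
  (e-diagonal : ∀ i → e i i ≡ 0ℚ) (s : Strategy n) where

  open Strategy s

  private
    p : ℕ → Vector ℚ n
    p m i = seq (prob i) m

  -- The coefficient of `w j i` in the IE revenue minus κ times that in the strategy's revenue. A
  -- single one may be negative, namely when the strategy approaches `j` first; the two directions
  -- are therefore always added.
  surplus : Fin n → Fin n → ℝ
  surplus i j = fromℚ (e i j) -
    fromℚ κ * ((prob i * (1ℝ - prob i)) * (fromℚ (before order j i) * prob j))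

  prob-nonneg : ∀ i → 0ℝ ≤ prob i
  prob-nonneg i = nonneg-mono {prob i - fromℚ ½}
    (λ m → 0≤q-p⇒p≤q (ℚ.≤-trans (ℚ.nonNegative⁻¹ ½) (ℚ.≤-reflexive (sym (cancel (p m i))))))
    (≤⇒nonneg-diff (prob≥½ i))
    where
    open +-*-Solver
    cancel : ∀ p → p ℚ.- (p ℚ.- ½) ≡ ½
    cancel = solve 1 (λ p → p :- (p :- con ½) := con ½) refl

  -- The subtracted product is nonnegative, so the right-hand side bounds the
  -- surplus of the pair from below.
  surplus-pair : ∀ {i j} → i ≢ j → (order ⟨$⟩ʳ j) Fin.< (order ⟨$⟩ʳ i) → ∀ m →
    seq (surplus i j + surplus j i) m ℚ.- κ ℚ.* (myopic (p m i) ℚ.* (1ℚ ℚ.- p m j)) ≡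
    α ℚ.- κ ℚ.* myopic (p m i)
  surplus-pair {i} {j} i≢j πj<πi m = begin
    ((e i j ℚ.- κ ℚ.* influence order (p m) i j) ℚ.+ (e j i ℚ.- κ ℚ.* influence order (p m) j i)) ℚ.-
      κ ℚ.* (myopic (p m i) ℚ.* (1ℚ ℚ.- p m j))
      ≡⟨ cong₂ (λ u v → ((e i j ℚ.- κ ℚ.* u) ℚ.+ (e j i ℚ.- κ ℚ.* v)) ℚ.-
           κ ℚ.* (myopic (p m i) ℚ.* (1ℚ ℚ.- p m j)))
         (influence-before order (p m) πj<πi)
         (influence-after order (p m) (ℕ.<-asym πj<πi)) ⟩
    ((e i j ℚ.- κ ℚ.* (myopic (p m i) ℚ.* p m j)) ℚ.+ (e j i ℚ.- κ ℚ.* 0ℚ)) ℚ.-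
      κ ℚ.* (myopic (p m i) ℚ.* (1ℚ ℚ.- p m j))
      ≡⟨ expand κ (e i j) (e j i) (myopic (p m i)) (p m j) ⟩
    (e i j ℚ.+ e j i) ℚ.- κ ℚ.* myopic (p m i)
      ≡⟨ cong (ℚ._- κ ℚ.* myopic (p m i)) (e-pair i≢j) ⟩
    α ℚ.- κ ℚ.* myopic (p m i)
      ∎
    where
    open ≡-Reasoning
    open +-*-Solver
    expand : ∀ κ e e′ x p → ((e ℚ.- κ ℚ.* (x ℚ.* p)) ℚ.+ (e′ ℚ.- κ ℚ.* 0ℚ)) ℚ.-
                              κ ℚ.* (x ℚ.* (1ℚ ℚ.- p)) ≡ (e ℚ.+ e′) ℚ.- κ ℚ.* x
    expand = solve 5 (λ κ e e′ x p →
      ((e :- κ :* (x :* p)) :+ (e′ :- κ :* con 0ℚ)) :- κ :* (x :* (con 1ℚ :- p)) :=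
      (e :+ e′) :- κ :* x) refl

  -- With x the `myopic` value of the later buyer `i`, the sum equals (α - κ x) + κ x (1 - p), where
  -- p belongs to `j`. The first part is nonnegative at every index, the second only as a real,
  -- because an approximant of p may exceed 1; hence the second is the base of the comparison.
  surplus-ordered : ∀ {i j} → i ≢ j → (order ⟨$⟩ʳ j) Fin.< (order ⟨$⟩ʳ i) →
                    0ℝ ≤ surplus i j + surplus j i
  surplus-ordered {i} {j} i≢j πj<πi = nonneg-mono
    {fromℚ κ * ((prob i * (1ℝ - prob i)) * (1ℝ - prob j))}
    (λ m → 0≤q-p⇒p≤q (ℚ.≤-trans
      (p≤q⇒0≤q-p (scaled-myopic≤ 0≤κ κ¼≤α (p m i)))
      (ℚ.≤-reflexive (sym (surplus-pair i≢j πj<πi m)))))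
    (nonneg-* {fromℚ κ} (nonneg-pointwise λ _ → 0≤κ)
      (nonneg-* {prob i * (1ℝ - prob i)} {1ℝ - prob j}
        (nonneg-* {prob i} {1ℝ - prob i} (prob-nonneg i) (≤⇒nonneg-diff (prob≤1 i)))
        (≤⇒nonneg-diff (prob≤1 j))))

  surplus-diagonal : ∀ i → 0ℝ ≤ surplus i i + surplus i i
  surplus-diagonal i = nonneg-pointwise {surplus i i + surplus i i} λ m →
    ℚ.≤-reflexive (sym (cong₂ ℚ._+_ (vanishes m) (vanishes m)))
    where
    open ≡-Reasoning
    vanishes : ∀ m → seq (surplus i i) m ≡ 0ℚ
    vanishes m = begin
      e i i ℚ.- κ ℚ.* influence order (p m) i i
        ≡⟨ cong₂ (λ x y → x ℚ.- κ ℚ.* y) (e-diagonal i)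
             (influence-after order (p m) {i} {i} (ℕ.<-irrefl refl)) ⟩
      0ℚ ℚ.- κ ℚ.* 0ℚ
        ≡⟨ cong (λ x → 0ℚ ℚ.- x) (ℚ.*-zeroʳ κ) ⟩
      0ℚ ∎

  surplus-nonneg : ∀ i j → 0ℝ ≤ surplus i j + surplus j i
  surplus-nonneg i j with Fin.<-cmp (order ⟨$⟩ʳ j) (order ⟨$⟩ʳ i)
  ... | tri< lt πj≢πi _ = surplus-ordered (λ i≡j → πj≢πi (cong (order ⟨$⟩ʳ_) (sym i≡j))) lt
  ... | tri> _ πj≢πi gt = nonneg-mono {surplus j i + surplus i j}
    (λ m → ℚ.≤-reflexive (ℚ.+-comm (seq (surplus j i) m) (seq (surplus i j) m)))
    (surplus-ordered (λ j≡i → πj≢πi (cong (order ⟨$⟩ʳ_) j≡i)) gt)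
  ... | tri≈ _ πj≡πi _ = subst (λ k → 0ℝ ≤ surplus i k + surplus k i)
    (sym (⟨$⟩ʳ-injective order πj≡πi)) (surplus-diagonal i)

  revenue-surplus : ∀ (G : SocialNetwork n) r →
    (∀ m → seq r m ≡ linear (λ _ → β) e (λ i j → seq (SocialNetwork.w G i j) m)) →
    0ℝ ≤ r - fromℚ κ * strategyRevenue G s
  revenue-surplus G r r≡ =
    let x , 0≤x , x≡ = linear-nonneg G loopSurplus surplus loopSurplus-nonneg surplus-nonneg
    in nonneg-mono {x} {r - fromℚ κ * strategyRevenue G s}
      (λ m → ℚ.≤-reflexive (trans (x≡ m) (difference m))) 0≤x
    where
    open ≡-Reasoning

    loopSurplus : Fin n → ℝ
    loopSurplus i = fromℚ β - fromℚ κ * (prob i * (1ℝ - prob i))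

    loopSurplus-nonneg : ∀ i → 0ℝ ≤ loopSurplus i
    loopSurplus-nonneg i =
      nonneg-pointwise {loopSurplus i} λ m → p≤q⇒0≤q-p (scaled-myopic≤ 0≤κ κ¼≤β (p m i))

    w : ℕ → Fin n → Fin n → ℚ
    w m i j = seq (SocialNetwork.w G i j) m

    difference : ∀ m →
      linear (λ i → seq (loopSurplus i) m) (λ i j → seq (surplus i j) m) (w m) ≡
      seq r m ℚ.- κ ℚ.* seq (revenue G order prob) m
    difference m = begin
      linear (λ i → β ℚ.- κ ℚ.* myopic (p m i))
             (λ i j → e i j ℚ.- κ ℚ.* influence order (p m) i j) (w m)
        ≡⟨ linear-difference κ {λ _ → β} {λ i → myopic (p m i)} {e} {influence order (p m)} (w m) ⟩
      linear (λ _ → β) e (w m) ℚ.-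
        κ ℚ.* linear (λ i → myopic (p m i)) (influence order (p m)) (w m)
        ≡⟨ cong₂ (λ u v → u ℚ.- κ ℚ.* v) (r≡ m) (revenue-linear G order prob m λ _ → refl) ⟨
      seq r m ℚ.- κ ℚ.* seq (revenue G order prob) m
        ∎

-- Revenue of a generalized IE strategy

module IERevenue {K} .{{_ : NonTrivial K}} (S : IE K) (q : Fin K → ℚ) (q-sum : sum q ≡ 1ℚ)
  (S≡q : ∀ k m → seq (IE.assignProb S k) m ≡ q k)
  (price : Fin K → ℚ) (price≡ : ∀ k m → seq (classProb k) m ≡ price k) where

  open Expectation q q-sum

  -- Earnings per unit of weight from buyers of classes `k` and `l`, the higher class paying. For k
  -- = l the branches coincide.
  pairRevenue : Fin K → Fin K → ℚ
  pairRevenue k l =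
    if does (l Fin.<? k) then myopic (price k) ℚ.* price l else myopic (price l) ℚ.* price k

  β α : ℚ
  β = sum λ k → q k ℚ.* myopic (price k)
  α = sum λ k → q k ℚ.* sum λ l → q l ℚ.* pairRevenue k l

  expectedInfluence : Fin n → Fin n → ℚ
  expectedInfluence i j = 𝔼 λ a π → influence π (price ∘ a) i j

  𝔼-linear : (g : Vector (Fin K) n → Permutation′ n → Fin n → ℚ)
    (c : Vector (Fin K) n → Permutation′ n → Fin n → Fin n → ℚ) (w : Fin n → Fin n → ℚ) →
    𝔼 (λ a π → linear (g a π) (c a π) w) ≡
    linear (λ i → 𝔼 λ a π → g a π i) (λ i j → 𝔼 λ a π → c a π i j) w
  𝔼-linear {n} g c w = trans
    (𝔼-+ (λ a π → sum λ i → g a π i ℚ.* w i i) (λ a π → sum λ i → sum λ j → c a π i j ℚ.* w j i))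
    (cong₂ ℚ._+_
      (trans (𝔼-sum λ i a π → g a π i ℚ.* w i i)
        (sum-cong-≗ {n} λ i → 𝔼-*ʳ (λ a π → g a π i) (w i i)))
      (trans (𝔼-sum λ i a π → sum λ j → c a π i j ℚ.* w j i)
        (sum-cong-≗ {n} λ i → trans (𝔼-sum λ j a π → c a π i j ℚ.* w j i)
          (sum-cong-≗ {n} λ j → 𝔼-*ʳ (λ a π → c a π i j) (w j i)))))

  seq-expectedRevenue : ∀ (G : SocialNetwork n) m →
    seq (expectedRevenue S G) m ≡ 𝔼 λ a π → seq (revenue G π (classProb ∘ a)) m
  seq-expectedRevenue {n} G m = trans
    (seq-listSum m
      (λ a → ∏ (IE.assignProb S ∘ a) * mean (map (λ π → revenue G π (classProb ∘ a)) (respecting a)))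
      (assignments K n))
    (sumOver-cong (assignments K n) λ {a} _ → cong₂ ℚ._*_
      (trans (seq-∏ m (IE.assignProb S ∘ a)) (product-cong λ i → S≡q (a i) m))
      (seq-mean m (λ π → revenue G π (classProb ∘ a)) (respecting a)))
    where
    product-cong : ∀ {n} {f g : Vector ℚ n} → (∀ i → f i ≡ g i) → product f ≡ product g
    product-cong {zero}  f≗g = refl
    product-cong {suc n} f≗g = cong₂ ℚ._*_ (f≗g zero) (product-cong (f≗g ∘ suc))

  expectedRevenue-linear : ∀ (G : SocialNetwork n) m → seq (expectedRevenue S G) m ≡
    linear (λ _ → β) expectedInfluence (λ i j → seq (SocialNetwork.w G i j) m)
  expectedRevenue-linear {n} G m = begin
    seq (expectedRevenue S G) m
      ≡⟨ seq-expectedRevenue G m ⟩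
    𝔼 (λ a π → seq (revenue G π (classProb ∘ a)) m)
      ≡⟨ 𝔼-cong (λ a π _ → revenue-linear G π (classProb ∘ a) m (λ i → price≡ (a i) m)) ⟩
    𝔼 (λ a π → linear (λ i → myopic (price (a i))) (influence π (price ∘ a)) wₘ)
      ≡⟨ 𝔼-linear (λ a _ i → myopic (price (a i))) (λ a π → influence π (price ∘ a)) wₘ ⟩
    linear (λ i → 𝔼 λ a _ → myopic (price (a i))) expectedInfluence wₘ
      ≡⟨ cong (ℚ._+ (sum λ i → sum λ j → expectedInfluence i j ℚ.* wₘ j i)) (sum-cong-≗ {n} λ i → cong (ℚ._* wₘ i i)
           (trans (𝔼-class (λ a → myopic (price (a i)))) (expectedValue-single (myopic ∘ price) i))) ⟩
    linear (λ _ → β) expectedInfluence wₘ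
      ∎
    where
    open ≡-Reasoning
    wₘ : Fin n → Fin n → ℚ
    wₘ i j = seq (SocialNetwork.w G i j) m

  pairRevenue-after : ∀ {k l} → l Fin.< k → pairRevenue k l ≡ myopic (price k) ℚ.* price l
  pairRevenue-after {k} {l} l<k = cong
    (if_then myopic (price k) ℚ.* price l else myopic (price l) ℚ.* price k)
    (dec-true (l Fin.<? k) l<k)

  pairRevenue-before : ∀ {k l} → ¬ l Fin.< k → pairRevenue k l ≡ myopic (price l) ℚ.* price k
  pairRevenue-before {k} {l} l≮k = cong
    (if_then myopic (price k) ℚ.* price l else myopic (price l) ℚ.* price k)
    (dec-false (l Fin.<? k) l≮k)

  -- Inside a class both orders of i and j earn the same, so the distribution of the
  -- orders plays no role.
  influence-pair : ∀ (a : Vector (Fin K) n) π {i j} → Respects a π → i ≢ j →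
    influence π (price ∘ a) i j ℚ.+ influence π (price ∘ a) j i ≡ pairRevenue (a i) (a j)
  influence-pair a π {i} {j} respects i≢j with Fin.<-cmp (π ⟨$⟩ʳ j) (π ⟨$⟩ʳ i)
  ... | tri≈ _ πj≡πi _ = contradiction (sym (⟨$⟩ʳ-injective π πj≡πi)) i≢j
  ... | tri> πj≮πi _ πi<πj = begin
    influence π (price ∘ a) i j ℚ.+ influence π (price ∘ a) j i
      ≡⟨ cong₂ ℚ._+_ (influence-after π (price ∘ a) πj≮πi) (influence-before π (price ∘ a) πi<πj) ⟩
    0ℚ ℚ.+ myopic (price (a j)) ℚ.* price (a i)
      ≡⟨ ℚ.+-identityˡ (myopic (price (a j)) ℚ.* price (a i)) ⟩
    myopic (price (a j)) ℚ.* price (a i)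
      ≡⟨ pairRevenue-before (πj≮πi ∘ respects j i) ⟨
    pairRevenue (a i) (a j)
      ∎
    where open ≡-Reasoning
  ... | tri< πj<πi _ πi≮πj = begin
    influence π (price ∘ a) i j ℚ.+ influence π (price ∘ a) j i
      ≡⟨ cong₂ ℚ._+_ (influence-before π (price ∘ a) πj<πi) (influence-after π (price ∘ a) πi≮πj) ⟩
    myopic (price (a i)) ℚ.* price (a j) ℚ.+ 0ℚ
      ≡⟨ ℚ.+-identityʳ (myopic (price (a i)) ℚ.* price (a j)) ⟩
    myopic (price (a i)) ℚ.* price (a j)
      ≡⟨ classes ⟩
    pairRevenue (a i) (a j)
      ∎
    where
    open ≡-Reasoning
    classes : myopic (price (a i)) ℚ.* price (a j) ≡ pairRevenue (a i) (a j)
    -- In a tie `pairRevenue` takes its else branch, with the roles of `i` and `j` exchanged; equal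
    -- classes give equal prices, so the products agree.
    classes with Fin.<-cmp (a j) (a i)
    ... | tri< aj<ai _ _ = sym (pairRevenue-after aj<ai)
    ... | tri≈ aj≮ai aj≡ai _ = trans
      (cong₂ (λ k l → myopic (price k) ℚ.* price l) (sym aj≡ai) aj≡ai)
      (sym (pairRevenue-before aj≮ai))
    ... | tri> _ _ ai<aj = contradiction (respects i j ai<aj) πi≮πj

  -- Adding the two directions before averaging removes the order: the sum depends on the two
  -- classes alone, and these are independent for distinct buyers.
  expectedInfluence-pair : ∀ {i j : Fin n} → i ≢ j →
    expectedInfluence i j ℚ.+ expectedInfluence j i ≡ α
  expectedInfluence-pair {i = i} {j} i≢j = begin
    expectedInfluence i j ℚ.+ expectedInfluence j i
      ≡⟨ 𝔼-+ (λ a π → influence π (price ∘ a) i j) (λ a π → influence π (price ∘ a) j i) ⟨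
    𝔼 (λ a π → influence π (price ∘ a) i j ℚ.+ influence π (price ∘ a) j i)
      ≡⟨ 𝔼-cong (λ a π respects → influence-pair a π respects i≢j) ⟩
    𝔼 (λ a _ → pairRevenue (a i) (a j))
      ≡⟨ 𝔼-class (λ a → pairRevenue (a i) (a j)) ⟩
    expectedValue (λ a → pairRevenue (a i) (a j))
      ≡⟨ expectedValue-pair pairRevenue i j i≢j ⟩
    α
      ∎
    where open ≡-Reasoning

  expectedInfluence-diagonal : ∀ (i : Fin n) → expectedInfluence i i ≡ 0ℚ
  expectedInfluence-diagonal {n} i = trans
    (𝔼-cong {n} λ a π _ → influence-after π (price ∘ a) {i} {i} (ℕ.<-irrefl refl)) (𝔼-const {n} 0ℚ)

  approximation : ∀ {κ} → 0ℚ ℚ.≤ κ → κ ℚ.* ¼ ℚ.≤ β → κ ℚ.* ¼ ℚ.≤ α →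
    (G : SocialNetwork n) → ApproximatesMaxRevenue G (fromℚ κ) (expectedRevenue S G)
  approximation {n} {κ} 0≤κ κ¼≤β κ¼≤α G = (λ s → nonneg-diff⇒≤ (surplus s)) ,
    -- For the strategy `s` attaining `M`, with revenue R, split r - κ M into (r - κ R) + κ (R - M);
    -- the last term is null.
    λ M → λ { ((s , R≃M) , _) → nonneg-diff⇒≤
      (nonneg-mono {(r - fromℚ κ * strategyRevenue G s) + fromℚ κ * (strategyRevenue G s - M)}
        (λ m → ℚ.≤-reflexive (telescope κ (seq r m) (seq (strategyRevenue G s) m) (seq M m)))
        (nonneg-+ (surplus s) (≃⇒nonneg-*-diff (fromℚ κ) R≃M))) }
    where
    r = expectedRevenue S G

    surplus : ∀ s → 0ℝ ≤ r - fromℚ κ * strategyRevenue G s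
    surplus s = Surplus.revenue-surplus 0≤κ κ¼≤β κ¼≤α expectedInfluence
      expectedInfluence-pair expectedInfluence-diagonal s G r (expectedRevenue-linear G)

    open +-*-Solver
    telescope : ∀ κ r t u → (r ℚ.- κ ℚ.* t) ℚ.+ κ ℚ.* (t ℚ.- u) ≡ r ℚ.- κ ℚ.* u
    telescope = solve 4 (λ κ r t u → (r :- κ :* t) :+ κ :* (t :- u) := r :- κ :* u) refl

-- Numerical values for the six classes

private
  -- The class prices are constant sequences, so their terms at index 0 already are the rational
  -- prices.
  module IE₆ = IERevenue ie₆ q₆ refl (λ _ _ → refl) (λ k → seq (classProb k) 0) (λ _ _ → refl)

  κ¼≤β : + 7032 / 10000 ℚ.* ¼ ℚ.≤ IE₆.β
  κ¼≤β = toWitness {a? = _ ℚ.≤? _} _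

  -- This is the binding inequality: α = 0.175806339 against 0.1758, while β = 0.17589. The next
  -- decimal, 0.7033 / 4 = 0.175825, would already exceed α.
  κ¼≤α : + 7032 / 10000 ℚ.* ¼ ℚ.≤ IE₆.α
  κ¼≤α = toWitness {a? = _ ℚ.≤? _} _

theorem3 : (n : ℕ) (G : SocialNetwork n) →
    ApproximatesMaxRevenue G (fromℚ (+ 7032 / 10000)) (expectedRevenue ie₆ G)
theorem3 n G = IE₆.approximation (ℚ.nonNegative⁻¹ (+ 7032 / 10000)) κ¼≤β κ¼≤α G
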